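{- There exists an absolute constant $\beta>0$ such that, for all positive integers $q,d$ satisfying $q\geq 1.59d+\beta$, the $q$-coloring model exhibits strong spatial mixing on the infinite $(d+1)$-regular tree $\mathbb{T}_d$ with exponentially decaying rate. That is, there exist constants $\alpha,C>0$ and a function $\zeta:\mathbb{Z}_{\geq 0}\rightarrow[0,1]$ satisfying $\zeta(\ell)\leq C\exp(-\alpha\ell)$ for all integers $\ell\geq 0$ such that for all finite subtrees $T$ of $\mathbb{T}_d$ the $q$-coloring model exhibits strong spatial mixing on $T$ with decay rate $\zeta$.
   Context: A proper $q$-coloring of a graph $G=(V,E)$ is a map $\sigma:V\to[q]=\{1,\dots,q\}$ with $\sigma(u)\neq\sigma(v)$ for every edge $(u,v)\in E$. $\Omega_G$ denotes the set of proper $q$-colorings of $G$ and, for finite $G$ with $\Omega_G\neq\emptyset$, $\mu_G$ denotes the uniform distribution on $\Omega_G$. For $\sigma\in\Omega_G$ and $\Lambda\subset V$, $\sigma_\Lambda$ is the restriction of $\sigma$ to $\Lambda$, and $\sigma_v$ is the color of $v$ under $\sigma$. An assignment $\eta:\Lambda\to[q]$ is extendible if there is $\sigma\in\Omega_G$ with $\sigma_\Lambda=\eta$. Strong spatial mixing: given $\zeta:\mathbb{Z}_{\geq 0}\to[0,1]$, the $q$-coloring model exhibits strong spatial mixing on a finite graph $G=(V,E)$ with decay rate $\zeta$ iff for every $v\in V$, every $\Lambda\subset V$, any two extendible assignments $\eta,\eta':\Lambda\to[q]$ and any color $c\in[q]$, $$\big|\mu_G(\sigma_v=c\mid\sigma_\Lambda=\eta)-\mu_G(\sigma_v=c\mid\sigma_\Lambda=\eta')\big|\leq\zeta\big(\mathrm{dist}(v,\Delta)\big),$$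 where $\Delta\subseteq\Lambda$ is the set of vertices where $\eta$ and $\eta'$ disagree and $\mathrm{dist}$ is graph distance in $G$ (if $\Delta=\emptyset$ the left side is $0$ and the condition is regarded as satisfied). For infinite $G$, the model exhibits strong spatial mixing on $G$ with decay rate $\zeta$ if it does so on every finite subgraph of $G$ with decay rate $\zeta$; for $\mathbb{T}_d$ the precise assertion is the one about finite subtrees in the claim. -}

module Defs where

open import Data.Fin.Base using (Fin; finToFun; funToFin)
open import Data.Fin.Properties using (all?; finToFun-funToFin)
  renaming (_≟_ to _≟ᶠ_)
open import Data.Fin.Subset using (Subset; _∈_)
open import Data.Fin.Subset.Properties using (_∈?_)
open import Data.Integer.Base using (+_)
open import Data.List.Base using (List; []; _∷_; length; filter; tabulate)
open import Data.List.Properties using (filter-some) renaming (≡-dec to List-≡-dec)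
open import Data.List.Relation.Unary.Any.Properties using (tabulate⁺)
open import Data.Nat.Base as ℕ using (ℕ; zero; suc)
open import Data.Product.Base using (Σ; ∃; _×_; _,_)
open import Data.Rational.Base as ℚ
  using (ℚ; 0ℚ; 1ℚ; _+_; _*_; _-_; _≤_; _<_; _/_; _÷_; ∣_∣; normalize)
open import Data.Rational.Properties using (+-*-rawSemiring; pos⇒nonZero; normalize-pos)
open import Data.Sum.Base using (_⊎_; inj₁; inj₂; swap)
open import Function.Definitions using (Injective)
open import Level using (0ℓ)
open import Relation.Binary.Core using (Rel; _=[_]⇒_)
import Relation.Binary.Definitions as B
open import Relation.Binary.PropositionalEquality
  using (_≡_; _≢_; refl; sym; trans; subst₂)
open import Relation.Nullary.Decidable using (map′; ¬?; _→-dec_; _×-dec_; _⊎-dec_)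
open import Relation.Nullary.Negation using (contradiction)
open import Relation.Nullary.Decidable.Core using (Dec; yes; no)
open import Relation.Unary using (Pred; Decidable)
import Algebra.Definitions.RawSemiring as RawSemiringDefs

open RawSemiringDefs +-*-rawSemiring public using (_^_)

------------------------------------------------------------------------
-- Graphs

record Graph (V : Set) : Set₁ where
  infix 4 _~_ _~?_
  field
    _~_      : Rel V 0ℓ
    _~?_     : B.Decidable _~_
    ~-sym    : B.Symmetric _~_
    ~-irrefl : B.Irreflexive _≡_ _~_

  data Walk : V → V → ℕ → Set where
    []  : ∀ {v} → Walk v v 0
    _∷_ : ∀ {u v w ℓ} → u ~ v → Walk v w ℓ → Walk u w (suc ℓ)

  Connected : Set
  Connected = ∀ u v → ∃ (Walk u v)

  -- dist(v , S) = ℓ.  No ℓ satisfies this when S is empty or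
  -- unreachable from v, i.e. when the distance is infinite.
  HasDistance : V → Pred V 0ℓ → ℕ → Set
  HasDistance v S ℓ =
    (∃ λ u → S u × Walk v u ℓ) × (∀ u m → S u → Walk v u m → ℓ ℕ.≤ m)

------------------------------------------------------------------------
-- The infinite (d+1)-regular tree 𝕋_d

-- Rooted at an arbitrary vertex.  The root has d+1 children; every other
-- vertex has one parent and d children.  `node i p` lies below the i-th
-- child of the root, with p listing the later turns, most recent first.
data TreeVertex (d : ℕ) : Set where
  root : TreeVertex d
  node : Fin (suc d) → List (Fin d) → TreeVertex d

data Child {d : ℕ} : Rel (TreeVertex d) 0ℓ where
  top  : ∀ {i} → Child root (node i [])
  down : ∀ {i p} k → Child (node i p) (node i (k ∷ p))

child? : ∀ {d} → B.Decidable (Child {d})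
child? root root = no λ ()
child? root (node i []) = yes top
child? root (node i (_ ∷ _)) = no λ ()
child? (node i p) root = no λ ()
child? (node i p) (node j []) = no λ ()
child? (node i p) (node j (k ∷ r)) =
  map′ (λ { (refl , refl) → down k }) (λ { (down _) → refl , refl })
       ((i ≟ᶠ j) ×-dec List-≡-dec _≟ᶠ_ p r)

𝕋 : (d : ℕ) → Graph (TreeVertex d)
𝕋 d = record
  { _~_      = λ u v → Child u v ⊎ Child v u
  ; _~?_     = λ u v → child? u v ⊎-dec child? v u
  ; ~-sym    = swap
  ; ~-irrefl = λ { refl (inj₁ ()) ; refl (inj₂ ()) }
  }

-- Subgraphs of 𝕋 d are acyclic, so its finite subtrees are its finite
-- connected subgraphs (not assumed induced), here with vertices numbered
-- by Fin order.
record FiniteSubtree (d : ℕ) : Set₁ where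
  field
    order     : ℕ
    graph     : Graph (Fin order)
    embed     : Fin order → TreeVertex d
    injective : Injective _≡_ _≡_ embed
    subgraph  : Graph._~_ graph =[ embed ]⇒ Graph._~_ (𝕋 d)
    connected : Graph.Connected graph

------------------------------------------------------------------------
-- Proper colourings of a finite graph and their uniform distribution

module Colouring {n : ℕ} (G : Graph (Fin n)) (q : ℕ) where
  open Graph G

  Map : Set
  Map = Fin n → Fin q

  Proper : Pred Map 0ℓ
  Proper σ = ∀ u v → u ~ v → σ u ≢ σ v

  proper? : Decidable Proper
  proper? σ = all? λ u → all? λ v → (u ~? v) →-dec ¬? (σ u ≟ᶠ σ v)

  maps : List Map
  maps = tabulate {n = q ℕ.^ n} finToFun

  #Proper : {A : Pred Map 0ℓ} → Decidable A → ℕ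
  #Proper A? = length (filter (λ σ → proper? σ ×-dec A? σ) maps)

  #Ω : ℕ
  #Ω = length (filter proper? maps)

  -- μ_G(A)
  μ : {A : Pred Map 0ℓ} → Decidable A → .{{_ : ℕ.NonZero #Ω}} → ℚ
  μ A? = + #Proper A? / #Ω

  -- μ_G(A ∣ B)
  μ[_∣_] : {A B : Pred Map 0ℓ} (A? : Decidable A) (B? : Decidable B) →
           .{{_ : ℕ.NonZero #Ω}} .{{_ : ℚ.NonZero (μ B?)}} → ℚ
  μ[ A? ∣ B? ] = μ (λ σ → A? σ ×-dec B? σ) ÷ μ B?

  Assignment : Subset n → Set
  Assignment Λ = ∀ v → .(v ∈ Λ) → Fin q

  module _ {Λ : Subset n} where

    -- σ_Λ = η
    Extends : Assignment Λ → Pred Map 0ℓ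
    Extends η σ = ∀ v (v∈Λ : v ∈ Λ) → σ v ≡ η v v∈Λ

    extends? : ∀ η → Decidable (Extends η)
    extends? η σ = all? λ v → at v (v ∈? Λ)
      where
      at : ∀ v → Dec (v ∈ Λ) → Dec (∀ (v∈Λ : v ∈ Λ) → σ v ≡ η v v∈Λ)
      at v (yes v∈Λ) = map′ (λ eq _ → eq) (λ f → f v∈Λ) (σ v ≟ᶠ η v v∈Λ)
      at v (no  v∉Λ) = yes λ v∈Λ → contradiction v∈Λ v∉Λ

    Extendible : Pred (Assignment Λ) 0ℓ
    Extendible η = ∃ λ σ → Proper σ × Extends η σ

    Disagree : Assignment Λ → Assignment Λ → Pred (Fin n) 0ℓ
    Disagree η η′ v = Σ (v ∈ Λ) λ v∈Λ → η v v∈Λ ≢ η′ v v∈Λ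

  HasColour : Fin n → Fin q → Pred Map 0ℓ
  HasColour v c σ = σ v ≡ c

  hasColour? : ∀ v c → Decidable (HasColour v c)
  hasColour? v c σ = σ v ≟ᶠ c

  -- Conditioning on an extendible assignment is well defined.
  module _ {Λ : Subset n} (η : Assignment Λ) where

    private
      listed : (σ : Map) → ∀ v → σ v ≡ finToFun (funToFin σ) v
      listed σ v = sym (finToFun-funToFin σ v)

      proper-listed : ∀ σ → Proper σ → Proper (finToFun (funToFin σ))
      proper-listed σ pr u v u~v = subst₂ _≢_ (listed σ u) (listed σ v) (pr u v u~v)

    #Ω-nonZero : Extendible η → ℕ.NonZero #Ω
    #Ω-nonZero (σ , pr , _) = ℕ.>-nonZero
      (filter-some proper? (tabulate⁺ (funToFin σ) (proper-listed σ pr)))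

    μ-nonZero : Extendible η → .{{_ : ℕ.NonZero #Ω}} → ℚ.NonZero (μ (extends? η))
    μ-nonZero (σ , pr , ex) =
      pos⇒nonZero (μ (extends? η)) {{normalize-pos (#Proper (extends? η)) #Ω}}
      where
      instance
        #≢0 : ℕ.NonZero (#Proper (extends? η))
        #≢0 = ℕ.>-nonZero
          (filter-some _ (tabulate⁺ (funToFin σ)
            (proper-listed σ pr , λ v v∈Λ → trans (sym (listed σ v)) (ex v v∈Λ))))

    -- μ_G(σ_v = c ∣ σ_Λ = η)
    marginal : Extendible η → Fin n → Fin q → ℚ
    marginal ext v c =
      μ[ hasColour? v c ∣ extends? η ] {{#Ω-nonZero ext}}
        {{μ-nonZero ext {{#Ω-nonZero ext}}}}

------------------------------------------------------------------------
-- Strong spatial mixing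

-- Quantifying over the value ℓ of dist(v , Δ) makes the condition vacuous
-- when Δ is empty or unreachable from v; the two marginals then agree.
StrongSpatialMixing : ∀ {n} → Graph (Fin n) → (q : ℕ) → (ζ : ℕ → ℚ) → Set
StrongSpatialMixing {n} G q ζ =
  ∀ (v : Fin n) (Λ : Subset n) (η η′ : Assignment Λ)
  (ext : Extendible η) (ext′ : Extendible η′) (c : Fin q) (ℓ : ℕ) →
  HasDistance v (Disagree η η′) ℓ →
  ∣ marginal η ext v c - marginal η′ ext′ v c ∣ ≤ ζ ℓ
  where
  open Graph G
  open Colouring G q

------------------------------------------------------------------------
-- Exponential bounds

fromℕ : ℕ → ℚ
fromℕ n = + n / 1

-- (1 + x/n)ⁿ for n = 1, 2, …, whose limit is exp x.
expApprox : ℚ → ℕ → ℚ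
expApprox x k = (1ℚ + x * (+ 1 / suc k)) ^ suc k

-- x ≤ lim s, for a convergent sequence s (the limit may be irrational).
infix 4 _≤lim_
_≤lim_ : ℚ → (ℕ → ℚ) → Set
x ≤lim s = ∀ ε → 0ℚ < ε → ∃ λ N → ∀ n → N ℕ.≤ n → x ≤ s n + ε

-- x ≤ C · exp y
infix 4 _≤_·exp_
_≤_·exp_ : ℚ → ℚ → ℚ → Set
x ≤ C ·exp y = x ≤lim λ n → C * expApprox y n

{-# OPTIONS --safe #-}

-- On a tree the marginal of a vertex is computed from the leaves upwards by
-- F(p)_c = w_c / ∑ w with w_c = ∏ (1 - p_s(c)), where s runs over the at most
-- D = d + 1 children.  A small relative perturbation of the messages p_s
-- contracts in χ²-distance: by Cauchy–Schwarz the squared relative change of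
-- w_c is at most about P_c ∑ p_s(c) x_s(c)² with P_c = ∑ p_s(c), while
-- w_c P_c ≤ ½ and ∑ w ≥ q - D, so that the D children together contribute a
-- factor of about D / 2(q - D) < 1.  Two boundary conditions are joined, two
-- levels above the disagreement, by a chain of N small perturbations with N
-- independent of the tree, and every link of the chain contracts on the way
-- to the root.

module Submission where

open import Defs
import Algebra.Properties.CommutativeMonoid.Sum as CommutativeMonoidSum
import Algebra.Properties.Semiring.Exp as SemiringExp
import Algebra.Properties.Semiring.Sum as SemiringSum
open import Algebra.Bundles using (CommutativeRing)
open import Data.Bool.Base using (if_then_else_; true; false)
open import Data.Fin.Base
  using (Fin; zero; suc; _↑ˡ_; _↑ʳ_; combine; finToFun; punchIn; punchOut)
open import Data.Fin.Properties
  using (punchIn-injective; punchInᵢ≢i; punchIn-punchOut; remQuot-combine; all?; any?)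
  renaming (_≟_ to _≟ᶠ_)
open import Data.Fin.Subset using (Subset; _∈_)
open import Data.Fin.Subset.Properties using (_∈?_)
open import Data.Integer.Base as ℤ using (+_)
import Data.Integer.Properties as ℤ
open import Data.List.Base using ([]; _∷_; length; filter; tabulate)
open import Data.List.Properties using () renaming (≡-dec to List-≡-dec)
open import Data.Maybe.Base using (Maybe; just; nothing)
open import Data.Nat.Base as ℕ using (ℕ; zero; suc; NonZero)
import Data.Nat.DivMod as ℕ
import Data.Nat.Properties as ℕ
open import Data.Product.Base using (_×_; _,_; proj₁; proj₂; ∃-syntax)
open import Data.Rational.Base as ℚ
  using (ℚ; 0ℚ; 1ℚ; ½; _+_; _*_; -_; _-_; _<_; _≤_; _≥_; _/_; _÷_; 1/_; ∣_∣; _⊓_; toℚᵘ; nonNegative; positive)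
open import Data.Rational.Properties
open import Data.Rational.Unnormalised.Base as ℚᵘ using (mkℚᵘ; *≡*)
import Data.Rational.Unnormalised.Properties as ℚᵘ
open import Data.Sum.Base using (_⊎_; inj₁; inj₂)
open import Data.Unit.Base using (⊤; tt)
open import Data.Vec.Functional using (insertAt) renaming (_∷_ to _∷ᶠ_)
open import Data.Vec.Functional.Properties using (insertAt-lookup; insertAt-punchIn)
open import Function.Base using (_∘_; id)
open import Function.Bundles using (_⇔_; mk⇔)
open import Function.Definitions using (Injective)
open import Level using (0ℓ)
open import Relation.Binary.Core using (_=[_]⇒_)
open import Relation.Binary.Definitions using (DecidableEquality)
open import Relation.Binary.PropositionalEquality
  using (_≡_; _≢_; _≗_; refl; sym; trans; cong; cong₂; subst; subst₂; module ≡-Reasoning)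
open import Relation.Nullary.Decidable
  using (Dec; does; yes; no; dec⇒maybe; from-yes; does-⇔; _×-dec_; _⊎-dec_; _→-dec_; ¬?; dec-true; dec-false; map′)
open import Relation.Nullary.Negation using (contradiction; ¬_)
open import Relation.Unary using (Pred; Decidable)
open import Tactic.RingSolver using (solve-∀)
open import Tactic.RingSolver.Core.AlmostCommutativeRing
  using (AlmostCommutativeRing; fromCommutativeRing)

-- The contraction is a first-order effect and cannot be applied directly to two boundary
-- conditions: a vertex where they disagree sends two different point masses, and no relative change
-- carries one to the other. One level up, a vertex pinned alike on both sides sends equal messages,
-- and an unpinned one sends values of `F`, which are at most 1/101 because the normaliser is at
-- least 101. Along a segment between such messages every 1 - p changes by factors close to 1. Only
-- one more application of `F` turns these into small relative changes of the messages themselves,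
-- which is why the chains start two levels up. The length N is of order D², so that the D children
-- together disturb a weight by at most 1/100 in each link. With q - D at least 0.59 D the leading
-- factor is 50/59, about 0.85. The corrections for 1 / (1 - p) and for the nonlinear terms raise it
-- to about 0.9001, still below (19/20)².

module Sum = SemiringSum (CommutativeRing.semiring +-*-commutativeRing)
module Product = CommutativeMonoidSum *-1-commutativeMonoid

open Sum using () renaming (sum to ∑)
open Product using () renaming (sum to ∏)

ℚ-ring : AlmostCommutativeRing 0ℓ 0ℓ
ℚ-ring = fromCommutativeRing +-*-commutativeRing λ p → dec⇒maybe (0ℚ ≟ p)

-- Ordered field arithmetic

0≤-diff : ∀ {p q} → p ≤ q → 0ℚ ≤ q - p
0≤-diff {p} {q} p≤q = subst (_≤ q - p) (+-inverseʳ p) (+-monoˡ-≤ (- p) p≤q)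

≤-by : ∀ {p q} r → 0ℚ ≤ r → q - p ≡ r → p ≤ q
≤-by {p} {q} r 0≤r eq = subst₂ _≤_ (+-identityˡ p) (trans (cong (_+ p) (sym eq)) (lemma q p))
  (+-monoˡ-≤ p 0≤r)
  where
  lemma : ∀ q p → q - p + p ≡ q
  lemma = solve-∀ ℚ-ring

+-nonneg : ∀ {p q} → 0ℚ ≤ p → 0ℚ ≤ q → 0ℚ ≤ p + q
+-nonneg = +-mono-≤

*-nonneg : ∀ {p q} → 0ℚ ≤ p → 0ℚ ≤ q → 0ℚ ≤ p * q
*-nonneg {p} {q} 0≤p 0≤q = subst (_≤ p * q) (*-zeroʳ p)
  (*-monoˡ-≤-nonNeg p {{nonNegative 0≤p}} 0≤q)

*-monoˡ-≤ : ∀ {p q r} → 0ℚ ≤ r → p ≤ q → r * p ≤ r * q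
*-monoˡ-≤ {r = r} 0≤r = *-monoˡ-≤-nonNeg r {{nonNegative 0≤r}}

*-monoʳ-≤ : ∀ {p q r} → 0ℚ ≤ r → p ≤ q → p * r ≤ q * r
*-monoʳ-≤ {r = r} 0≤r = *-monoʳ-≤-nonNeg r {{nonNegative 0≤r}}

*-mono-≤ : ∀ {p q r s} → 0ℚ ≤ q → 0ℚ ≤ r → p ≤ q → r ≤ s → p * r ≤ q * s
*-mono-≤ 0≤q 0≤r p≤q r≤s = ≤-trans (*-monoʳ-≤ 0≤r p≤q) (*-monoˡ-≤ 0≤q r≤s)

*-pos : ∀ {p q} → 0ℚ < p → 0ℚ < q → 0ℚ < p * q
*-pos {p} {q} 0<p 0<q = positive⁻¹ (p * q) {{pos*pos⇒pos p {{positive 0<p}} q {{positive 0<q}}}}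

0≤p*p : ∀ p → 0ℚ ≤ p * p
0≤p*p p with ≤-total 0ℚ p
... | inj₁ 0≤p = *-nonneg 0≤p 0≤p
... | inj₂ p≤0 = subst (0ℚ ≤_) (lemma p) (*-nonneg 0≤-p 0≤-p)
  where
  lemma : ∀ p → (- p) * (- p) ≡ p * p
  lemma = solve-∀ ℚ-ring
  0≤-p : 0ℚ ≤ - p
  0≤-p = neg-antimono-≤ p≤0

*-cancelʳ-≤ : ∀ {p q r} → 0ℚ < r → p * r ≤ q * r → p ≤ q
*-cancelʳ-≤ {r = r} 0<r = *-cancelʳ-≤-pos r {{positive 0<r}}

square-cancel-≤ : ∀ {p q} → 0ℚ ≤ q → p * p ≤ q * q → p ≤ q
square-cancel-≤ {p} {q} 0≤q p²≤q² with p ≤? q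
... | yes p≤q = p≤q
... | no  p≰q = contradiction p²≤q² (<⇒≱ (≤-<-trans
        (*-monoˡ-≤ 0≤q (<⇒≤ q<p))
        (*-monoˡ-<-pos p {{positive (≤-<-trans 0≤q q<p)}} q<p)))
  where
  q<p : q < p
  q<p = ≰⇒> p≰q
  <⇒≱ : ∀ {a b} → a < b → b ≤ a → _
  <⇒≱ a<b b≤a = <-irrefl refl (<-≤-trans a<b b≤a)

∣p∣*∣p∣≡p*p : ∀ p → ∣ p ∣ * ∣ p ∣ ≡ p * p
∣p∣*∣p∣≡p*p p = trans (sym (∣p*q∣≡∣p∣*∣q∣ p p)) (0≤p⇒∣p∣≡p (0≤p*p p))

p≤∣p∣ : ∀ p → p ≤ ∣ p ∣
p≤∣p∣ p = square-cancel-≤ (0≤∣p∣ p) (≤-reflexive (sym (∣p∣*∣p∣≡p*p p)))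

-∣p∣≤p : ∀ p → - ∣ p ∣ ≤ p
-∣p∣≤p p = subst (- ∣ p ∣ ≤_) (lemma p)
  (neg-antimono-≤ (subst (- p ≤_) (∣-p∣≡∣p∣ p) (p≤∣p∣ (- p))))
  where
  lemma : ∀ p → - (- p) ≡ p
  lemma = solve-∀ ℚ-ring

∣p∣≤ : ∀ {p q} → p ≤ q → - q ≤ p → ∣ p ∣ ≤ q
∣p∣≤ {p} {q} p≤q -q≤p with ∣p∣≡p∨∣p∣≡-p p
... | inj₁ eq = subst (_≤ q) (sym eq) p≤q
... | inj₂ eq = subst (_≤ q) (sym eq) (subst (- p ≤_) (lemma q) (neg-antimono-≤ -q≤p))
  where
  lemma : ∀ p → - (- p) ≡ p
  lemma = solve-∀ ℚ-ring

-- inv 0 = 0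
opaque
  inv : ℚ → ℚ
  inv p with p ≟ 0ℚ
  ... | yes _   = 0ℚ
  ... | no  p≢0 = (1/ p) {{ℚ.≢-nonZero p≢0}}

  *-invʳ : ∀ {p} → 0ℚ < p → p * inv p ≡ 1ℚ
  *-invʳ {p} 0<p with p ≟ 0ℚ
  ... | yes p≡0 = contradiction (sym p≡0) (<⇒≢ 0<p)
  ... | no  p≢0 = *-inverseʳ p {{ℚ.≢-nonZero p≢0}}

  inv-nonneg : ∀ {p} → 0ℚ < p → 0ℚ ≤ inv p
  inv-nonneg {p} 0<p = *-cancelʳ-≤ 0<p (subst₂ _≤_ (sym (*-zeroˡ p))
    (sym (trans (*-comm (inv p) p) (*-invʳ 0<p))) (from-yes (0ℚ ≤? 1ℚ)))

*-inv-unique : ∀ {p q r} → 0ℚ < q → p ≡ r * q → p * inv q ≡ r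
*-inv-unique {p} {q} {r} 0<q p≡rq = begin
  p * inv q        ≡⟨ cong (_* inv q) p≡rq ⟩
  r * q * inv q    ≡⟨ *-assoc r q (inv q) ⟩
  r * (q * inv q)  ≡⟨ cong (r *_) (*-invʳ 0<q) ⟩
  r * 1ℚ           ≡⟨ *-identityʳ r ⟩
  r                ∎
  where open ≡-Reasoning

*-inv-≤ : ∀ {p q r} → 0ℚ < q → p ≤ r * q → p * inv q ≤ r
*-inv-≤ {p} {q} {r} 0<q p≤rq = subst (p * inv q ≤_) (*-inv-unique 0<q refl)
  (*-monoʳ-≤ (inv-nonneg 0<q) p≤rq)

fromℕ-suc : ∀ n → fromℕ (suc n) ≡ 1ℚ + fromℕ n
fromℕ-suc n = toℚᵘ-injective (begin
  toℚᵘ (fromℕ (suc n))              ≈⟨ toℚᵘ-fromℚᵘ (mkℚᵘ (+ suc n) 0) ⟩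
  mkℚᵘ (+ suc n) 0                  ≈⟨ *≡* (cong (ℤ._* + 1) (cong (λ z → + 1 ℤ.+ z) (sym (ℤ.*-identityʳ (+ n))))) ⟩
  toℚᵘ 1ℚ ℚᵘ.+ mkℚᵘ (+ n) 0         ≈⟨ ℚᵘ.+-congʳ (toℚᵘ 1ℚ) (ℚᵘ.≃-sym (toℚᵘ-fromℚᵘ (mkℚᵘ (+ n) 0))) ⟩
  toℚᵘ 1ℚ ℚᵘ.+ toℚᵘ (fromℕ n)       ≈⟨ ℚᵘ.≃-sym (toℚᵘ-homo-+ 1ℚ (fromℕ n)) ⟩
  toℚᵘ (1ℚ + fromℕ n)               ∎)
  where open ℚᵘ.≃-Reasoning

fromℕ-nonneg : ∀ n → 0ℚ ≤ fromℕ n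
fromℕ-nonneg n = nonNegative⁻¹ (fromℕ n) {{normalize-nonNeg n 1}}

fromℕ-pos : ∀ n .{{_ : ℕ.NonZero n}} → 0ℚ < fromℕ n
fromℕ-pos n@(suc _) = positive⁻¹ (fromℕ n) {{normalize-pos n 1}}

fromℕ-mono-≤ : ∀ {m n} → m ℕ.≤ n → fromℕ m ≤ fromℕ n
fromℕ-mono-≤ {n = n} ℕ.z≤n = fromℕ-nonneg n
fromℕ-mono-≤ (ℕ.s≤s {m} {n} m≤n) = subst₂ _≤_ (sym (fromℕ-suc m)) (sym (fromℕ-suc n))
  (+-monoʳ-≤ 1ℚ (fromℕ-mono-≤ m≤n))

fromℕ-+ : ∀ m n → fromℕ (m ℕ.+ n) ≡ fromℕ m + fromℕ n
fromℕ-+ zero n = sym (+-identityˡ (fromℕ n))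
fromℕ-+ (suc m) n = begin
  fromℕ (suc (m ℕ.+ n))       ≡⟨ fromℕ-suc (m ℕ.+ n) ⟩
  1ℚ + fromℕ (m ℕ.+ n)        ≡⟨ cong (λ z → 1ℚ + z) (fromℕ-+ m n) ⟩
  1ℚ + (fromℕ m + fromℕ n)    ≡⟨ +-assoc 1ℚ (fromℕ m) (fromℕ n) ⟨
  1ℚ + fromℕ m + fromℕ n      ≡⟨ cong (_+ fromℕ n) (fromℕ-suc m) ⟨
  fromℕ (suc m) + fromℕ n     ∎
  where open ≡-Reasoning

fromℕ-* : ∀ m n → fromℕ (m ℕ.* n) ≡ fromℕ m * fromℕ n
fromℕ-* zero n = sym (*-zeroˡ (fromℕ n))
fromℕ-* (suc m) n = begin
  fromℕ (n ℕ.+ m ℕ.* n)            ≡⟨ fromℕ-+ n (m ℕ.* n) ⟩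
  fromℕ n + fromℕ (m ℕ.* n)        ≡⟨ cong (λ z → fromℕ n + z) (fromℕ-* m n) ⟩
  fromℕ n + fromℕ m * fromℕ n      ≡⟨ lemma (fromℕ m) (fromℕ n) ⟩
  (1ℚ + fromℕ m) * fromℕ n         ≡⟨ cong (_* fromℕ n) (fromℕ-suc m) ⟨
  fromℕ (suc m) * fromℕ n          ∎
  where
  open ≡-Reasoning
  lemma : ∀ m n → n + m * n ≡ (1ℚ + m) * n
  lemma = solve-∀ ℚ-ring

-- Finite sums and products

∑-cong : ∀ {n} {f g : Fin n → ℚ} → f ≗ g → ∑ f ≡ ∑ g
∑-cong = Sum.sum-cong-≗

∏-cong : ∀ {n} {f g : Fin n → ℚ} → f ≗ g → ∏ f ≡ ∏ g
∏-cong = Product.sum-cong-≗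

∑-mono : ∀ {n} {f g : Fin n → ℚ} → (∀ i → f i ≤ g i) → ∑ f ≤ ∑ g
∑-mono {zero}  f≤g = ≤-refl
∑-mono {suc n} f≤g = +-mono-≤ (f≤g zero) (∑-mono (λ i → f≤g (suc i)))

∑-nonneg : ∀ {n} {f : Fin n → ℚ} → (∀ i → 0ℚ ≤ f i) → 0ℚ ≤ ∑ f
∑-nonneg {zero}  0≤f = ≤-refl
∑-nonneg {suc n} 0≤f = +-nonneg (0≤f zero) (∑-nonneg (λ i → 0≤f (suc i)))

∑-const : ∀ n p → ∑ {n} (λ _ → p) ≡ fromℕ n * p
∑-const zero p = sym (*-zeroˡ p)
∑-const (suc n) p = begin
  p + ∑ {n} (λ _ → p)    ≡⟨ cong (λ z → p + z) (∑-const n p) ⟩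
  p + fromℕ n * p        ≡⟨ lemma (fromℕ n) p ⟩
  (1ℚ + fromℕ n) * p     ≡⟨ cong (_* p) (fromℕ-suc n) ⟨
  fromℕ (suc n) * p      ∎
  where
  open ≡-Reasoning
  lemma : ∀ m n → n + m * n ≡ (1ℚ + m) * n
  lemma = solve-∀ ℚ-ring

∑-*ˡ : ∀ {n} p (f : Fin n → ℚ) → ∑ (λ i → p * f i) ≡ p * ∑ f
∑-*ˡ p f = sym (Sum.*-distribˡ-sum p f)

∑-*ʳ : ∀ {n} p (f : Fin n → ℚ) → ∑ (λ i → f i * p) ≡ ∑ f * p
∑-*ʳ p f = sym (Sum.*-distribʳ-sum p f)

∑-+ : ∀ {n} (f g : Fin n → ℚ) → ∑ (λ i → f i + g i) ≡ ∑ f + ∑ g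
∑-+ = Sum.∑-distrib-+

∑-swap : ∀ {m n} (f : Fin m → Fin n → ℚ) → ∑ (λ i → ∑ λ j → f i j) ≡ ∑ (λ j → ∑ λ i → f i j)
∑-swap = Sum.∑-comm

∑-neg : ∀ {n} (f : Fin n → ℚ) → ∑ (λ i → - f i) ≡ - ∑ f
∑-neg {zero}  f = refl
∑-neg {suc n} f = trans (cong (λ z → - f zero + z) (∑-neg (λ i → f (suc i))))
  (sym (neg-distrib-+ (f zero) (∑ (λ i → f (suc i)))))

∑-- : ∀ {n} (f g : Fin n → ℚ) → ∑ (λ i → f i - g i) ≡ ∑ f - ∑ g
∑-- f g = trans (∑-+ f (λ i → - g i)) (cong (λ z → ∑ f + z) (∑-neg g))

term≤∑ : ∀ {n} {f : Fin n → ℚ} → (∀ i → 0ℚ ≤ f i) → ∀ i → f i ≤ ∑ f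
term≤∑ {suc n} {f} 0≤f zero = subst (_≤ ∑ f) (+-identityʳ (f zero))
  (+-monoʳ-≤ (f zero) (∑-nonneg (λ i → 0≤f (suc i))))
term≤∑ {suc n} {f} 0≤f (suc i) = subst (_≤ ∑ f) (+-identityˡ (f (suc i)))
  (+-mono-≤ (0≤f zero) (term≤∑ (λ i → 0≤f (suc i)) i))

∣∑∣≤∑∣∣ : ∀ {n} (f : Fin n → ℚ) → ∣ ∑ f ∣ ≤ ∑ (λ i → ∣ f i ∣)
∣∑∣≤∑∣∣ {zero}  f = ≤-refl
∣∑∣≤∑∣∣ {suc n} f = ≤-trans (∣p+q∣≤∣p∣+∣q∣ (f zero) _) (+-monoʳ-≤ ∣ f zero ∣ (∣∑∣≤∑∣∣ (λ i → f (suc i))))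

∏-* : ∀ {n} (f g : Fin n → ℚ) → ∏ (λ i → f i * g i) ≡ ∏ f * ∏ g
∏-* = Product.∑-distrib-+

∏-nonneg : ∀ {n} {f : Fin n → ℚ} → (∀ i → 0ℚ ≤ f i) → 0ℚ ≤ ∏ f
∏-nonneg {zero}  0≤f = from-yes (0ℚ ≤? 1ℚ)
∏-nonneg {suc n} 0≤f = *-nonneg (0≤f zero) (∏-nonneg (λ i → 0≤f (suc i)))

∏≤1 : ∀ {n} {f : Fin n → ℚ} → (∀ i → 0ℚ ≤ f i) → (∀ i → f i ≤ 1ℚ) → ∏ f ≤ 1ℚ
∏≤1 {zero}  0≤f f≤1 = ≤-refl
∏≤1 {suc n} 0≤f f≤1 = *-mono-≤ (from-yes (0ℚ ≤? 1ℚ)) (∏-nonneg (λ i → 0≤f (suc i)))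
  (f≤1 zero) (∏≤1 (λ i → 0≤f (suc i)) (λ i → f≤1 (suc i)))

∏[1-p]≥1-∑p : ∀ {n} {p : Fin n → ℚ} → (∀ i → 0ℚ ≤ p i) → (∀ i → p i ≤ 1ℚ) →
              1ℚ - ∑ p ≤ ∏ (λ i → 1ℚ - p i)
∏[1-p]≥1-∑p {zero} 0≤p p≤1 = ≤-refl
∏[1-p]≥1-∑p {suc n} {p} 0≤p p≤1 = ≤-trans
  (≤-by (p zero * P) (*-nonneg (0≤p zero) (∑-nonneg (λ i → 0≤p (suc i)))) (lemma (p zero) P))
  (*-monoˡ-≤ (0≤-diff (p≤1 zero)) (∏[1-p]≥1-∑p (λ i → 0≤p (suc i)) (λ i → p≤1 (suc i))))
  where
  P = ∑ (λ i → p (suc i))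
  lemma : ∀ p P → (1ℚ - p) * (1ℚ - P) - (1ℚ - (p + P)) ≡ p * P
  lemma = solve-∀ ℚ-ring

-- Three terms of the exponential series bound ∏ (1 - pᵢ) by
-- 1 / (1 + P + P²/2), where P = ∑ pᵢ, and 1 + P + P²/2 ≥ 2 P.
∏[1-p]*∑p≤½ : ∀ {n} {p : Fin n → ℚ} → (∀ i → 0ℚ ≤ p i) → (∀ i → p i ≤ 1ℚ) →
              ∏ (λ i → 1ℚ - p i) * ∑ p ≤ ½
∏[1-p]*∑p≤½ {p = p} 0≤p p≤1 = ≤-trans
  (≤-by (½ * ½ * (w * ((P - 1ℚ) * (P - 1ℚ) + 1ℚ)))
    (*-nonneg (from-yes (0ℚ ≤? ½ * ½)) (*-nonneg 0≤w
      (+-nonneg (0≤p*p (P - 1ℚ)) (from-yes (0ℚ ≤? 1ℚ)))))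
    (lemma w P))
  (*-monoˡ-≤ (from-yes (0ℚ ≤? ½)) (bound p 0≤p p≤1))
  where
  w = ∏ (λ i → 1ℚ - p i)
  P = ∑ p
  0≤w : 0ℚ ≤ w
  0≤w = ∏-nonneg (λ i → 0≤-diff (p≤1 i))
  g : ℚ → ℚ
  g P = 1ℚ + P + ½ * (P * P)
  lemma : ∀ w P → ½ * (w * (1ℚ + P + ½ * (P * P))) - w * P ≡
          ½ * ½ * (w * ((P - 1ℚ) * (P - 1ℚ) + 1ℚ))
  lemma = solve-∀ ℚ-ring
  step : ∀ a w P → 1ℚ - (1ℚ - a) * w * (1ℚ + (a + P) + ½ * ((a + P) * (a + P))) ≡
         (1ℚ - w * (1ℚ + P + ½ * (P * P))) +
         w * (½ * (a * ((P + a) * (P + a) + a)))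
  step = solve-∀ ℚ-ring
  bound : ∀ {n} (p : Fin n → ℚ) → (∀ i → 0ℚ ≤ p i) → (∀ i → p i ≤ 1ℚ) →
          ∏ (λ i → 1ℚ - p i) * g (∑ p) ≤ 1ℚ
  bound {zero}  p 0≤p p≤1 = ≤-refl
  bound {suc n} p 0≤p p≤1 = ≤-by _
    (+-nonneg (0≤-diff (bound (λ i → p (suc i)) (λ i → 0≤p (suc i)) (λ i → p≤1 (suc i))))
      (*-nonneg (∏-nonneg (λ i → 0≤-diff (p≤1 (suc i))))
        (*-nonneg (from-yes (0ℚ ≤? ½)) (*-nonneg (0≤p zero)
          (+-nonneg (0≤p*p (P′ + p zero)) (0≤p zero))))))
    (step (p zero) (∏ (λ i → 1ℚ - p (suc i))) P′)
    where
    P′ = ∑ (λ i → p (suc i))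

-- The deviation is at most ∏ (1 + tᵢ) - 1, and ∏ (1 + tᵢ) ≤ 1 / (1 - T) with T = ∑ t, which gives T
-- / (1 - T). The bound is cross-multiplied to avoid the division.
∣∏[1-s]-1∣ : ∀ {n} (s t : Fin n → ℚ) → (∀ i → ∣ s i ∣ ≤ t i) → ∑ t ≤ 1ℚ →
             ∣ ∏ (λ i → 1ℚ - s i) - 1ℚ ∣ * (1ℚ - ∑ t) ≤ ∑ t
∣∏[1-s]-1∣ {zero}  s t s≤t ∑t≤1 = ≤-refl
∣∏[1-s]-1∣ {suc n} s t s≤t ∑t≤1 = ≤-trans
  (*-monoʳ-≤ 0≤1-T′ ∣X′∣≤)
  (≤-by _
    (+-nonneg (*-nonneg 0≤1+a (0≤-diff ih)) (*-nonneg 0≤a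
       (+-nonneg (*-nonneg 0≤1+a (0≤∣p∣ X)) 0≤a)))
    (lemma ∣ X ∣ a T))
  where
  X = ∏ (λ i → 1ℚ - s (suc i)) - 1ℚ
  a = t zero
  T = ∑ (λ i → t (suc i))
  0≤t : ∀ i → 0ℚ ≤ t i
  0≤t i = ≤-trans (0≤∣p∣ (s i)) (s≤t i)
  0≤a = 0≤t zero
  0≤1+a : 0ℚ ≤ 1ℚ + a
  0≤1+a = +-nonneg (from-yes (0ℚ ≤? 1ℚ)) 0≤a
  0≤1-T′ : 0ℚ ≤ 1ℚ - (a + T)
  0≤1-T′ = 0≤-diff ∑t≤1
  T≤1 : T ≤ 1ℚ
  T≤1 = ≤-trans (≤-by a 0≤a (cancel a T)) ∑t≤1
    where
    cancel : ∀ a T → a + T - T ≡ a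
    cancel = solve-∀ ℚ-ring
  ih : ∣ X ∣ * (1ℚ - T) ≤ T
  ih = ∣∏[1-s]-1∣ (λ i → s (suc i)) (λ i → t (suc i)) (λ i → s≤t (suc i)) T≤1
  expand : ∀ s w → (1ℚ - s) * w - 1ℚ ≡ (w - 1ℚ) + (- s + (- s) * (w - 1ℚ))
  expand = solve-∀ ℚ-ring
  regroup : ∀ x a → x + (a + a * x) ≡ (1ℚ + a) * x + a
  regroup = solve-∀ ℚ-ring
  ∣-s∣≤a : ∣ - s zero ∣ ≤ a
  ∣-s∣≤a = subst (_≤ a) (sym (∣-p∣≡∣p∣ (s zero))) (s≤t zero)
  ∣X′∣≤ : ∣ ∏ (λ i → 1ℚ - s i) - 1ℚ ∣ ≤ (1ℚ + a) * ∣ X ∣ + a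
  ∣X′∣≤ = subst₂ _≤_ (cong ∣_∣ (sym (expand (s zero) _))) (regroup ∣ X ∣ a)
    (≤-trans (∣p+q∣≤∣p∣+∣q∣ X _) (+-monoʳ-≤ ∣ X ∣
      (≤-trans (∣p+q∣≤∣p∣+∣q∣ (- s zero) _) (+-mono-≤ ∣-s∣≤a
        (subst (_≤ a * ∣ X ∣) (sym (∣p*q∣≡∣p∣*∣q∣ (- s zero) X)) (*-monoʳ-≤ (0≤∣p∣ X) ∣-s∣≤a))))))
  lemma : ∀ x a T → a + T - ((1ℚ + a) * x + a) * (1ℚ - (a + T)) ≡
          (1ℚ + a) * (T - x * (1ℚ - T)) + a * ((1ℚ + a) * x + a)
  lemma = solve-∀ ℚ-ring

-- Induction on the number of terms keeps square roots out: a new term with value b requires 2 A b ≤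
-- P b² + E, and this follows by squaring, since (P b² + E)² ≥ 4 P E b² ≥ 4 A² b² by the induction
-- hypothesis.
cauchy-schwarz : ∀ {n} (p x : Fin n → ℚ) → (∀ i → 0ℚ ≤ p i) →
                 ∑ (λ i → p i * x i) * ∑ (λ i → p i * x i) ≤ ∑ p * ∑ (λ i → p i * (x i * x i))
cauchy-schwarz {zero}  p x 0≤p = ≤-refl
cauchy-schwarz {suc n} p x 0≤p = ≤-by _
  (+-nonneg (0≤-diff ih) (*-nonneg (0≤p zero) (0≤-diff amgm)))
  (expand (p zero) (x zero) A P E)
  where
  A = ∑ (λ i → p (suc i) * x (suc i))
  P = ∑ (λ i → p (suc i))
  E = ∑ (λ i → p (suc i) * (x (suc i) * x (suc i)))
  b = x zero
  ih : A * A ≤ P * E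
  ih = cauchy-schwarz (λ i → p (suc i)) (λ i → x (suc i)) (λ i → 0≤p (suc i))
  0≤P : 0ℚ ≤ P
  0≤P = ∑-nonneg (λ i → 0≤p (suc i))
  0≤E : 0ℚ ≤ E
  0≤E = ∑-nonneg (λ i → *-nonneg (0≤p (suc i)) (0≤p*p (x (suc i))))
  complete : ∀ b A P E → (P * (b * b) + E) * (P * (b * b) + E) - (A * b + A * b) * (A * b + A * b) ≡
             (P * (b * b) - E) * (P * (b * b) - E) +
             (1ℚ + 1ℚ) * (1ℚ + 1ℚ) * (b * b * (P * E - A * A))
  complete = solve-∀ ℚ-ring
  amgm : A * b + A * b ≤ P * (b * b) + E
  amgm = square-cancel-≤ (+-nonneg (*-nonneg 0≤P (0≤p*p b)) 0≤E)
    (≤-by _ (+-nonneg (0≤p*p (P * (b * b) - E)) (*-nonneg (from-yes (0ℚ ≤? (1ℚ + 1ℚ) * (1ℚ + 1ℚ)))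
       (*-nonneg (0≤p*p b) (0≤-diff ih))))
      (complete b A P E))
  expand : ∀ p b A P E → (p + P) * (p * (b * b) + E) - (p * b + A) * (p * b + A) ≡
           (P * E - A * A) + p * ((P * (b * b) + E) - (A * b + A * b))
  expand = solve-∀ ℚ-ring

-- The tree recursion and its contraction

Message : ℕ → Set
Message q = Fin q → ℚ

record IsMessage {q} (p : Message q) : Set where
  field
    nonneg : ∀ c → 0ℚ ≤ p c
    ∑≤1    : ∑ p ≤ 1ℚ

  ≤1 : ∀ c → p c ≤ 1ℚ
  ≤1 c = ≤-trans (term≤∑ nonneg c) ∑≤1

open IsMessage

Small : ∀ {q} → Message q → Set
Small p = ∀ c → p c ≤ + 1 / 101

-- χ²-distance at most r²; x and s are the relative changes of p and 1 - p.
record Close {q} (r : ℚ) (p p′ : Message q) : Set where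
  field
    x      : Fin q → ℚ
    step   : ∀ c → p′ c ≡ p c + p c * x c
    energy : ∑ (λ c → p c * (x c * x c)) ≤ r * r
    s      : Fin q → ℚ
    factor : ∀ c → 1ℚ - p′ c ≡ (1ℚ - p c) * (1ℚ - s c)
    ∣s∣≤   : ∀ c → ∣ s c ∣ ≤ + 101 / 100 * (p c * ∣ x c ∣)

-- The change s of 1 - p is separate data rather than a quotient: a point mass has 1 - p = 0 at its
-- colour, and s = 0 still satisfies the product equation there.
Close-refl : ∀ {q r} {p p′ : Message q} → p ≗ p′ → Close r p p′
Close-refl {q} {r} {p} {p′} p≗p′ = record
  { x      = λ _ → 0ℚ
  ; step   = λ c → trans (sym (p≗p′ c)) (lemma₁ (p c))
  ; energy = subst (_≤ r * r) (sym (trans (∑-cong (λ c → *-zeroʳ (p c)))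
               (trans (∑-const q 0ℚ) (*-zeroʳ (fromℕ q))))) (0≤p*p r)
  ; s      = λ _ → 0ℚ
  ; factor = λ c → trans (cong (λ z → 1ℚ - z) (sym (p≗p′ c))) (lemma₂ (p c))
  ; ∣s∣≤   = λ c → ≤-reflexive (sym (lemma₃ (p c)))
  }
  where
  lemma₁ : ∀ a → a ≡ a + a * 0ℚ
  lemma₁ = solve-∀ ℚ-ring
  lemma₂ : ∀ a → 1ℚ - a ≡ (1ℚ - a) * (1ℚ - 0ℚ)
  lemma₂ = solve-∀ ℚ-ring
  lemma₃ : ∀ a → + 101 / 100 * (a * 0ℚ) ≡ 0ℚ
  lemma₃ = solve-∀ ℚ-ring

inv[1-p]≤ : ∀ {p} → p ≤ + 1 / 101 → 0ℚ < 1ℚ - p × inv (1ℚ - p) ≤ + 101 / 100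
inv[1-p]≤ {p} p≤ = 0<1-p , subst (_≤ + 101 / 100) (*-identityˡ _) (*-inv-≤ {1ℚ} 0<1-p
  (≤-by (+ 101 / 100 * (+ 1 / 101 - p)) (*-nonneg (from-yes (0ℚ ≤? + 101 / 100)) (0≤-diff p≤))
    (lemma p)))
  where
  0<1-p : 0ℚ < 1ℚ - p
  0<1-p = <-≤-trans (from-yes (0ℚ <? + 100 / 101))
    (≤-by (+ 1 / 101 - p) (0≤-diff p≤) (lemma′ p))
    where
    lemma′ : ∀ p → 1ℚ - p - + 100 / 101 ≡ + 1 / 101 - p
    lemma′ = solve-∀ ℚ-ring
  lemma : ∀ p → + 101 / 100 * (1ℚ - p) - 1ℚ ≡ + 101 / 100 * (+ 1 / 101 - p)
  lemma = solve-∀ ℚ-ring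

module _ {q r} {p p′ : Message q} (isM : IsMessage p) (cl : Close r p p′) (0≤r : 0ℚ ≤ r) where
  open Close cl

  p∣x∣²≤ : ∀ c → (p c * ∣ x c ∣) * (p c * ∣ x c ∣) ≤ p c * (x c * x c)
  p∣x∣²≤ c = subst (_≤ p c * (x c * x c)) (lemma (p c) ∣ x c ∣)
    (subst (λ z → p c * (p c * (∣ x c ∣ * ∣ x c ∣)) ≤ p c * z) (∣p∣*∣p∣≡p*p (x c))
      (*-monoˡ-≤ (nonneg isM c) (subst (p c * (∣ x c ∣ * ∣ x c ∣) ≤_) (*-identityˡ _)
        (*-monoʳ-≤ (*-nonneg (0≤∣p∣ (x c)) (0≤∣p∣ (x c))) (≤1 isM c)))))
    where
    lemma : ∀ p x → p * (p * (x * x)) ≡ (p * x) * (p * x)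
    lemma = solve-∀ ℚ-ring

  -- As p ≤ 1, a single term p x² of the energy already dominates (p x)². This uniform bound keeps
  -- the disturbance small in the next application of `F`, and it turns the final χ²-estimate into
  -- one on probabilities.
  p∣x∣≤r : ∀ c → p c * ∣ x c ∣ ≤ r
  p∣x∣≤r c = square-cancel-≤ 0≤r (≤-trans (p∣x∣²≤ c)
    (≤-trans (term≤∑ (λ c → *-nonneg (nonneg isM c) (0≤p*p (x c))) c) energy))

  Close⇒∣p-p′∣≤ : ∀ c → ∣ p c - p′ c ∣ ≤ r
  Close⇒∣p-p′∣≤ c = subst (_≤ r) (sym eq) (p∣x∣≤r c)
    where
    lemma : ∀ p x → p - (p + p * x) ≡ - (p * x)
    lemma = solve-∀ ℚ-ring
    eq : ∣ p c - p′ c ∣ ≡ p c * ∣ x c ∣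
    eq = begin
      ∣ p c - p′ c ∣               ≡⟨ cong (λ z → ∣ p c - z ∣) (step c) ⟩
      ∣ p c - (p c + p c * x c) ∣  ≡⟨ cong ∣_∣ (lemma (p c) (x c)) ⟩
      ∣ - (p c * x c) ∣            ≡⟨ ∣-p∣≡∣p∣ (p c * x c) ⟩
      ∣ p c * x c ∣                ≡⟨ ∣p*q∣≡∣p∣*∣q∣ (p c) (x c) ⟩
      ∣ p c ∣ * ∣ x c ∣            ≡⟨ cong (_* ∣ x c ∣) (0≤p⇒∣p∣≡p (nonneg isM c)) ⟩
      p c * ∣ x c ∣                ∎
      where open ≡-Reasoning

-- The quotient s = p y / (1 - p) is available because p ≤ 1/101 keeps 1 - p away from 0; 1 / (1 -
-- 1/101) = 101/100 is the constant in `Close`.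
small⇒Close : ∀ {q r} {p p′ : Message q} → IsMessage p → Small p → (y : Fin q → ℚ) →
              (∀ c → p′ c ≡ p c + p c * y c) → ∑ (λ c → p c * (y c * y c)) ≤ r * r → Close r p p′
small⇒Close {p = p} {p′} isM small y step energy = record
  { x = y ; step = step ; energy = energy
  ; s = λ c → p c * y c * inv (1ℚ - p c)
  ; factor = λ c → trans (cong (λ z → 1ℚ - z) (step c)) (sym (factor c))
  ; ∣s∣≤ = bound
  }
  where
  lemma : ∀ p y i → (1ℚ - p) * (1ℚ - p * y * i) ≡ 1ℚ - p - p * y * ((1ℚ - p) * i)
  lemma = solve-∀ ℚ-ring
  lemma′ : ∀ p y → 1ℚ - p - p * y * 1ℚ ≡ 1ℚ - (p + p * y)
  lemma′ = solve-∀ ℚ-ring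
  factor : ∀ c → (1ℚ - p c) * (1ℚ - p c * y c * inv (1ℚ - p c)) ≡ 1ℚ - (p c + p c * y c)
  factor c = trans (lemma (p c) (y c) (inv (1ℚ - p c)))
    (trans (cong (λ z → 1ℚ - p c - p c * y c * z) (*-invʳ (proj₁ (inv[1-p]≤ (small c))))) (lemma′ (p c) (y c)))
  bound : ∀ c → ∣ p c * y c * inv (1ℚ - p c) ∣ ≤ + 101 / 100 * (p c * ∣ y c ∣)
  bound c = subst (_≤ + 101 / 100 * (p c * ∣ y c ∣)) (sym eq)
    (subst (_≤ + 101 / 100 * (p c * ∣ y c ∣)) (*-comm (inv (1ℚ - p c)) (p c * ∣ y c ∣))
      (*-monoʳ-≤ (*-nonneg (nonneg isM c) (0≤∣p∣ (y c))) (proj₂ (inv[1-p]≤ (small c)))))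
    where
    eq : ∣ p c * y c * inv (1ℚ - p c) ∣ ≡ p c * ∣ y c ∣ * inv (1ℚ - p c)
    eq = trans (∣p*q∣≡∣p∣*∣q∣ (p c * y c) _) (cong₂ _*_
      (trans (∣p*q∣≡∣p∣*∣q∣ (p c) (y c)) (cong (_* ∣ y c ∣) (0≤p⇒∣p∣≡p (nonneg isM c))))
      (0≤p⇒∣p∣≡p (inv-nonneg (proj₁ (inv[1-p]≤ (small c))))))

weight : ∀ {D q} → (Fin D → Message q) → Message q
weight p c = ∏ λ s → 1ℚ - p s c

total : ∀ {D q} → (Fin D → Message q) → ℚ
total p = ∑ (weight p)

F : ∀ {D q} → (Fin D → Message q) → Message q
F p c = weight p c * inv (total p)

weight-cong : ∀ {D q} {p p′ : Fin D → Message q} → (∀ s → p s ≗ p′ s) → weight p ≗ weight p′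
weight-cong p≗p′ c = ∏-cong λ s → cong (λ z → 1ℚ - z) (p≗p′ s c)

F-cong : ∀ {D q} {p p′ : Fin D → Message q} → (∀ s → p s ≗ p′ s) → F p ≗ F p′
F-cong p≗p′ c = cong₂ _*_ (weight-cong p≗p′ c) (cong inv (∑-cong (weight-cong p≗p′)))

module Recursion (D q : ℕ)
  (101≤gap : + 101 / 1 ≤ fromℕ q - fromℕ D)
  (D≤gap : fromℕ D ≤ + 100 / 59 * (fromℕ q - fromℕ D))
  where

  gap : ℚ
  gap = fromℕ q - fromℕ D

  module _ {p : Fin D → Message q} (isM : ∀ s → IsMessage (p s)) where

    weight-nonneg : ∀ c → 0ℚ ≤ weight p c
    weight-nonneg c = ∏-nonneg λ s → 0≤-diff (≤1 (isM s) c)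

    -- By ∏ (1 - p) ≥ 1 - ∑ p for every colour, the total falls short of q by at most the mass of
    -- all messages, and each of the D messages has mass at most 1.
    gap≤total : gap ≤ total p
    gap≤total = ≤-trans
      (+-mono-≤ (≤-reflexive (sym (trans (∑-const q 1ℚ) (*-identityʳ (fromℕ q)))))
        (neg-antimono-≤ (subst (∑ (λ c → ∑ λ s → p s c) ≤_) (trans (∑-const D 1ℚ) (*-identityʳ (fromℕ D)))
          (≤-trans (≤-reflexive (∑-swap (λ c s → p s c))) (∑-mono (λ s → ∑≤1 (isM s)))))))
      (subst (_≤ total p) (∑-- (λ _ → 1ℚ) (λ c → ∑ λ s → p s c))
        (∑-mono λ c → ∏[1-p]≥1-∑p (λ s → nonneg (isM s) c) (λ s → ≤1 (isM s) c)))

    101≤total : + 101 / 1 ≤ total p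
    101≤total = ≤-trans 101≤gap gap≤total

    total-pos : 0ℚ < total p
    total-pos = <-≤-trans (from-yes (0ℚ <? + 101 / 1)) 101≤total

    F-nonneg : ∀ c → 0ℚ ≤ F p c
    F-nonneg c = *-nonneg (weight-nonneg c) (inv-nonneg total-pos)

    ∑F≡1 : ∑ (F p) ≡ 1ℚ
    ∑F≡1 = trans (∑-*ʳ (inv (total p)) (weight p)) (*-invʳ total-pos)

    F-isMessage : IsMessage (F p)
    F-isMessage = record { nonneg = F-nonneg ; ∑≤1 = ≤-reflexive ∑F≡1 }

    -- A weight is at most 1, so the lower bound 101 on the normaliser makes every value of `F`
    -- small.
    F-small : Small (F p)
    F-small c = *-inv-≤ total-pos (≤-trans
      (∏≤1 (λ s → 0≤-diff (≤1 (isM s) c))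
           (λ s → ≤-by (p s c) (nonneg (isM s) c) (lemma (p s c))))
      (*-monoˡ-≤ (from-yes (0ℚ ≤? + 1 / 101)) 101≤total))
      where
      lemma : ∀ p → 1ℚ - (1ℚ - p) ≡ p
      lemma = solve-∀ ℚ-ring

  -- Normalising a vector with relative perturbations X subtracts the mean m
  -- of X under F p, which only decreases the second moment.
  perturb : ∀ {p p′ : Fin D → Message q} → (∀ s → IsMessage (p s)) → (∀ s → IsMessage (p′ s)) →
    (s t : Fin D → Fin q → ℚ) → (∀ i c → 1ℚ - p′ i c ≡ (1ℚ - p i c) * (1ℚ - s i c)) →
    (∀ i c → ∣ s i c ∣ ≤ t i c) → (∀ c → ∑ (λ i → t i c) ≤ + 1 / 100) →
    ∃[ y ] (∀ c → F p′ c ≡ F p c + F p c * y c) ×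
           ∑ (λ c → F p c * (y c * y c)) ≤
           + 2500 / 2401 * ∑ (λ c → F p c * (∑ (λ i → t i c) * ∑ (λ i → t i c)))
  perturb {p} {p′} isM isM′ s t factor s≤t ∑t≤ = y , F′≡ , second-moment
    where
    w = weight p
    f = F p
    i = inv (total p)
    T : Fin q → ℚ
    T c = ∑ λ i → t i c
    X : Fin q → ℚ
    X c = ∏ (λ i → 1ℚ - s i c) - 1ℚ

    w′≡ : ∀ c → weight p′ c ≡ w c * (1ℚ + X c)
    w′≡ c = trans (∏-cong (λ i → factor i c)) (trans (∏-* (λ i → 1ℚ - p i c) (λ i → 1ℚ - s i c))
      (cong (w c *_) (lemma _)))
      where
      lemma : ∀ a → a ≡ 1ℚ + (a - 1ℚ)
      lemma = solve-∀ ℚ-ring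

    0≤T : ∀ c → 0ℚ ≤ T c
    0≤T c = ∑-nonneg λ i → ≤-trans (0≤∣p∣ (s i c)) (s≤t i c)

    -- T ≤ 1/100 turns T / (1 - T) into at most 100/99 T.
    ∣X∣≤T : ∀ c → ∣ X c ∣ ≤ + 100 / 99 * T c
    ∣X∣≤T c = *-cancelʳ-≤ {r = + 99 / 100} (from-yes (0ℚ <? + 99 / 100)) (≤-trans
      (*-monoˡ-≤ (0≤∣p∣ (X c)) (≤-by _ (0≤-diff (∑t≤ c)) (lemma (T c))))
      (≤-trans (∣∏[1-s]-1∣ (λ i → s i c) (λ i → t i c) (λ i → s≤t i c)
                 (≤-trans (∑t≤ c) (from-yes (+ 1 / 100 ≤? 1ℚ))))
        (≤-reflexive (lemma′ (T c)))))
      where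
      lemma : ∀ T → (1ℚ - T) - + 99 / 100 ≡ + 1 / 100 - T
      lemma = solve-∀ ℚ-ring
      lemma′ : ∀ T → T ≡ + 100 / 99 * T * (+ 99 / 100)
      lemma′ = solve-∀ ℚ-ring

    ∣X∣≤ : ∀ c → ∣ X c ∣ ≤ + 1 / 99
    ∣X∣≤ c = ≤-trans (∣X∣≤T c) (*-monoˡ-≤ (from-yes (0ℚ ≤? + 100 / 99)) (∑t≤ c))

    m : ℚ
    m = ∑ λ c → f c * X c

    -1/99≤m : - (+ 1 / 99) ≤ m
    -1/99≤m = subst (_≤ m) (trans (∑-*ʳ (- (+ 1 / 99)) f) (trans (cong (_* (- (+ 1 / 99))) (∑F≡1 isM)) refl))
      (∑-mono λ c → *-monoˡ-≤ (F-nonneg isM c)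
        (≤-trans (neg-antimono-≤ (∣X∣≤ c)) (-∣p∣≤p (X c))))

    98/99≤1+m : + 98 / 99 ≤ 1ℚ + m
    98/99≤1+m = +-monoʳ-≤ 1ℚ -1/99≤m

    0<1+m : 0ℚ < 1ℚ + m
    0<1+m = <-≤-trans (from-yes (0ℚ <? + 98 / 99)) 98/99≤1+m

    k = inv (1ℚ + m)

    0≤k : 0ℚ ≤ k
    0≤k = inv-nonneg 0<1+m

    k≤ : k ≤ + 99 / 98
    k≤ = subst (_≤ + 99 / 98) (*-identityˡ k) (*-inv-≤ {1ℚ} 0<1+m
      (*-monoˡ-≤ (from-yes (0ℚ ≤? + 99 / 98)) 98/99≤1+m))

    y : Fin q → ℚ
    y c = (X c - m) * k

    wi : total p * i ≡ 1ℚ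
    wi = *-invʳ (total-pos isM)

    ∑wX : ∑ (λ c → w c * X c) ≡ total p * m
    ∑wX = begin
      ∑ (λ c → w c * X c)                  ≡⟨ ∑-cong (λ c → trans (sym (*-identityˡ _)) (trans (cong (_* (w c * X c)) (sym wi)) (lemma (total p) i (w c) (X c)))) ⟩
      ∑ (λ c → total p * (f c * X c))      ≡⟨ ∑-*ˡ (total p) (λ c → f c * X c) ⟩
      total p * m                          ∎
      where
      open ≡-Reasoning
      lemma : ∀ W i w X → W * i * (w * X) ≡ W * (w * i * X)
      lemma = solve-∀ ℚ-ring

    total′≡ : total p′ ≡ total p * (1ℚ + m)
    total′≡ = begin
      ∑ (weight p′)                         ≡⟨ ∑-cong w′≡ ⟩
      ∑ (λ c → w c * (1ℚ + X c))            ≡⟨ ∑-cong (λ c → lemma (w c) (X c)) ⟩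
      ∑ (λ c → w c + w c * X c)             ≡⟨ ∑-+ w (λ c → w c * X c) ⟩
      total p + ∑ (λ c → w c * X c)         ≡⟨ cong (λ z → total p + z) ∑wX ⟩
      total p + total p * m                 ≡⟨ lemma (total p) m ⟨
      total p * (1ℚ + m)                    ∎
      where
      open ≡-Reasoning
      lemma : ∀ w x → w * (1ℚ + x) ≡ w + w * x
      lemma = solve-∀ ℚ-ring

    -- (1 + X) / (1 + m) = 1 + (X - m) / (1 + m) is the origin of `y`. The two units inserted by
    -- `lemma₁` are replaced by `total p * i` and `(1ℚ + m) * k`.
    F′≡ : ∀ c → F p′ c ≡ f c + f c * y c
    F′≡ c = *-inv-unique (total-pos isM′) (begin
      weight p′ c                                     ≡⟨ w′≡ c ⟩
      w c * (1ℚ + X c)                                ≡⟨ lemma₁ (w c) (X c) m ⟩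
      1ℚ * (w c * (1ℚ + m + (X c - m) * 1ℚ))          ≡⟨ cong₂ (λ a b → a * (w c * (1ℚ + m + (X c - m) * b))) (sym wi) (sym (*-invʳ 0<1+m)) ⟩
      total p * i * (w c * (1ℚ + m + (X c - m) * ((1ℚ + m) * k)))
                                                      ≡⟨ lemma₂ (total p) i (w c) (X c) m k ⟩
      (f c + f c * y c) * (total p * (1ℚ + m))        ≡⟨ cong ((f c + f c * y c) *_) total′≡ ⟨
      (f c + f c * y c) * total p′                    ∎)
      where
      open ≡-Reasoning
      lemma₁ : ∀ w X m → w * (1ℚ + X) ≡ 1ℚ * (w * (1ℚ + m + (X - m) * 1ℚ))
      lemma₁ = solve-∀ ℚ-ring
      lemma₂ : ∀ W i w X m k → W * i * (w * (1ℚ + m + (X - m) * ((1ℚ + m) * k))) ≡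
               (w * i + w * i * ((X - m) * k)) * (W * (1ℚ + m))
      lemma₂ = solve-∀ ℚ-ring

    X² : ℚ
    X² = ∑ λ c → f c * (X c * X c)

    variance : ∑ (λ c → f c * ((X c - m) * (X c - m))) ≡ X² - m * m
    variance = begin
      ∑ (λ c → f c * ((X c - m) * (X c - m)))
        ≡⟨ ∑-cong (λ c → lemma (f c) (X c) m) ⟩
      ∑ (λ c → f c * (X c * X c) + (f c * X c * (- m - m) + f c * (m * m)))
        ≡⟨ ∑-+ (λ c → f c * (X c * X c)) _ ⟩
      X² + ∑ (λ c → f c * X c * (- m - m) + f c * (m * m))
        ≡⟨ cong (λ z → X² + z) (∑-+ (λ c → f c * X c * (- m - m)) (λ c → f c * (m * m))) ⟩
      X² + (∑ (λ c → f c * X c * (- m - m)) + ∑ (λ c → f c * (m * m)))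
        ≡⟨ cong (λ z → X² + z) (cong₂ _+_ (∑-*ʳ (- m - m) (λ c → f c * X c)) (trans (∑-*ʳ (m * m) f) (cong (_* (m * m)) (∑F≡1 isM)))) ⟩
      X² + (m * (- m - m) + 1ℚ * (m * m))
        ≡⟨ lemma′ X² m ⟩
      X² - m * m ∎
      where
      open ≡-Reasoning
      lemma : ∀ f X m → f * ((X - m) * (X - m)) ≡ f * (X * X) + (f * X * (- m - m) + f * (m * m))
      lemma = solve-∀ ℚ-ring
      lemma′ : ∀ A m → A + (m * (- m - m) + 1ℚ * (m * m)) ≡ A - m * m
      lemma′ = solve-∀ ℚ-ring

    variance≤ : ∑ (λ c → f c * ((X c - m) * (X c - m))) ≤ X²
    variance≤ = subst (_≤ X²) (sym variance) (≤-by (m * m) (0≤p*p m) (lemma X² (m * m)))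
      where
      lemma : ∀ A m → A - (A - m) ≡ m
      lemma = solve-∀ ℚ-ring

    T² : ℚ
    T² = ∑ λ c → f c * (T c * T c)

    X²≤ : X² ≤ (+ 100 / 99) * (+ 100 / 99) * T²
    X²≤ = subst (X² ≤_) (∑-*ˡ ((+ 100 / 99) * (+ 100 / 99)) (λ c → f c * (T c * T c)))
      (∑-mono λ c → subst (f c * (X c * X c) ≤_) (lemma (f c) (T c))
        (*-monoˡ-≤ (F-nonneg isM c) (subst (_≤ + 100 / 99 * T c * (+ 100 / 99 * T c)) (∣p∣*∣p∣≡p*p (X c))
          (*-mono-≤ (*-nonneg (from-yes (0ℚ ≤? + 100 / 99)) (0≤T c)) (0≤∣p∣ (X c)) (∣X∣≤T c) (∣X∣≤T c)))))
      where
      lemma : ∀ f T → f * ((+ 100 / 99) * T * ((+ 100 / 99) * T)) ≡ (+ 100 / 99) * (+ 100 / 99) * (f * (T * T))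
      lemma = solve-∀ ℚ-ring

    -- The factors 99/98, from 1 + m ≥ 98/99, and 100/99, from the bound on X, combine to 50/49,
    -- whose square is the constant.
    second-moment : ∑ (λ c → f c * (y c * y c)) ≤ + 2500 / 2401 * T²
    second-moment = begin
      ∑ (λ c → f c * (y c * y c))                            ≡⟨ ∑-cong (λ c → lemma (f c) (X c - m) k) ⟩
      ∑ (λ c → k * k * (f c * ((X c - m) * (X c - m))))      ≡⟨ ∑-*ˡ (k * k) (λ c → f c * ((X c - m) * (X c - m))) ⟩
      k * k * ∑ (λ c → f c * ((X c - m) * (X c - m)))        ≤⟨ *-monoˡ-≤ (0≤p*p k) (≤-trans variance≤ X²≤) ⟩
      k * k * ((+ 100 / 99) * (+ 100 / 99) * T²)             ≤⟨ *-monoʳ-≤ (*-nonneg (from-yes (0ℚ ≤? (+ 100 / 99) * (+ 100 / 99))) 0≤T²) (*-mono-≤ (from-yes (0ℚ ≤? + 99 / 98)) 0≤k k≤ k≤) ⟩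
      (+ 99 / 98) * (+ 99 / 98) * ((+ 100 / 99) * (+ 100 / 99) * T²) ≡⟨ lemma′ T² ⟩
      + 2500 / 2401 * T²                                     ∎
      where
      open ≤-Reasoning
      lemma : ∀ f z k → f * (z * k * (z * k)) ≡ k * k * (f * (z * z))
      lemma = solve-∀ ℚ-ring
      lemma′ : ∀ T → (+ 99 / 98) * (+ 99 / 98) * ((+ 100 / 99) * (+ 100 / 99) * T) ≡ + 2500 / 2401 * T
      lemma′ = solve-∀ ℚ-ring
      0≤T² : 0ℚ ≤ T²
      0≤T² = ∑-nonneg λ c → *-nonneg (F-nonneg isM c) (0≤p*p (T c))

-- Convex interpolation between messages

mix : ∀ {q} → ℚ → Message q → Message q → Message q
mix κ p p′ c = p c + κ * (p′ c - p c)

mix-0 : ∀ {q} (p p′ : Message q) → mix 0ℚ p p′ ≗ p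
mix-0 p p′ c = lemma (p c) (p′ c)
  where
  lemma : ∀ a b → a + 0ℚ * (b - a) ≡ a
  lemma = solve-∀ ℚ-ring

mix-1 : ∀ {q} (p p′ : Message q) → mix 1ℚ p p′ ≗ p′
mix-1 p p′ c = lemma (p c) (p′ c)
  where
  lemma : ∀ a b → a + 1ℚ * (b - a) ≡ b
  lemma = solve-∀ ℚ-ring

mix-convex : ∀ κ a b → a + κ * (b - a) ≡ (1ℚ - κ) * a + κ * b
mix-convex = solve-∀ ℚ-ring

module _ {q} {κ : ℚ} (0≤κ : 0ℚ ≤ κ) (κ≤1 : κ ≤ 1ℚ) {p p′ : Message q} where

  mix-≤ : ∀ {a b u} → a ≤ u → b ≤ u → a + κ * (b - a) ≤ u
  mix-≤ {a} {b} {u} a≤u b≤u = subst₂ _≤_ (sym (mix-convex κ a b)) (lemma κ u)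
    (+-mono-≤ (*-monoˡ-≤ (0≤-diff κ≤1) a≤u) (*-monoˡ-≤ 0≤κ b≤u))
    where
    lemma : ∀ κ u → (1ℚ - κ) * u + κ * u ≡ u
    lemma = solve-∀ ℚ-ring

  mix-isMessage : IsMessage p → IsMessage p′ → IsMessage (mix κ p p′)
  mix-isMessage isM isM′ = record
    { nonneg = λ c → subst (0ℚ ≤_) (sym (mix-convex κ (p c) (p′ c)))
        (+-nonneg (*-nonneg (0≤-diff κ≤1) (nonneg isM c)) (*-nonneg 0≤κ (nonneg isM′ c)))
    ; ∑≤1 = subst (_≤ 1ℚ) (sym eq) (mix-≤ (∑≤1 isM) (∑≤1 isM′))
    }
    where
    eq : ∑ (mix κ p p′) ≡ ∑ p + κ * (∑ p′ - ∑ p)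
    eq = trans (∑-+ p (λ c → κ * (p′ c - p c)))
      (cong (λ z → ∑ p + z) (trans (∑-*ˡ κ (λ c → p′ c - p c)) (cong (κ *_) (∑-- p′ p))))

  mix-small : Small p → Small p′ → Small (mix κ p p′)
  mix-small sm sm′ c = mix-≤ (sm c) (sm′ c)

-- The two possibilities one level above the disagreement: a vertex pinned alike, where 1 - p may
-- vanish but nothing changes, or an unpinned one, where 1 - p is invertible.
EqualOrSmall : ∀ {q} → Message q → Message q → Set
EqualOrSmall p p′ = p ≗ p′ ⊎ Small p × Small p′

-- The decay per level: its square 0.9025 exceeds 100/59 · ½ · (101/100)² · (50/49)² ≈ 0.9001, the
-- bound for the factor by which one application of `F` changes the energy.
σ : ℚ
σ = + 19 / 20

-- Contraction over one level

module Contraction (d q : ℕ)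
  (101≤gap : + 101 / 1 ≤ fromℕ q - fromℕ (suc d))
  (D≤gap : fromℕ (suc d) ≤ + 100 / 59 * (fromℕ q - fromℕ (suc d)))
  where

  private
    D : ℕ
    D = suc d

  open Recursion D q 101≤gap D≤gap

  contract : ∀ {r} {p p′ : Fin D → Message q} → 0ℚ ≤ r → fromℕ D * r ≤ + 1 / 200 →
    (∀ s → IsMessage (p s)) → (∀ s → IsMessage (p′ s)) → (∀ s → Close r (p s) (p′ s)) →
    Close (σ * r) (F p) (F p′)
  contract {r} {p} {p′} 0≤r Dr≤ isM isM′ close =
    small⇒Close (F-isMessage isM) (F-small isM) (proj₁ result) (proj₁ (proj₂ result))
      (≤-trans (proj₂ (proj₂ result)) second-moment)
    where
    B = + 101 / 100
    x : Fin D → Fin q → ℚ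
    x s = Close.x (close s)
    t : Fin D → Fin q → ℚ
    t s c = B * (p s c * ∣ x s c ∣)
    A E P T : Fin q → ℚ
    A c = ∑ λ s → p s c * ∣ x s c ∣
    E c = ∑ λ s → p s c * (x s c * x s c)
    P c = ∑ λ s → p s c
    T c = ∑ λ s → t s c
    w = weight p
    i = inv (total p)
    0≤i : 0ℚ ≤ i
    0≤i = inv-nonneg (total-pos isM)

    -- D r ≤ 1/200 leaves room for the factor 101/100 within the 1/100 that `perturb` admits.
    T≤ : ∀ c → T c ≤ + 1 / 100
    T≤ c = ≤-trans
      (∑-mono λ s → *-monoˡ-≤ (from-yes (0ℚ ≤? B)) (p∣x∣≤r (isM s) (close s) 0≤r c))
      (subst (_≤ + 1 / 100) (sym (trans (∑-const D (B * r)) (lemma (fromℕ D) r)))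
        (≤-trans (*-monoˡ-≤ (from-yes (0ℚ ≤? B)) Dr≤) (from-yes (B * (+ 1 / 200) ≤? + 1 / 100))))
      where
      lemma : ∀ D r → D * (+ 101 / 100 * r) ≡ + 101 / 100 * (D * r)
      lemma = solve-∀ ℚ-ring

    result = perturb isM isM′ (λ s → Close.s (close s)) t
      (λ s → Close.factor (close s)) (λ s → Close.∣s∣≤ (close s)) T≤

    A²≤PE : ∀ c → A c * A c ≤ P c * E c
    A²≤PE c = subst (λ z → A c * A c ≤ P c * z)
      (∑-cong λ s → cong (p s c *_) (∣p∣*∣p∣≡p*p (x s c)))
      (cauchy-schwarz (λ s → p s c) (λ s → ∣ x s c ∣) (λ s → nonneg (isM s) c))

    0≤E : ∀ c → 0ℚ ≤ E c
    0≤E c = ∑-nonneg λ s → *-nonneg (nonneg (isM s) c) (0≤p*p (x s c))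

    fT²≤ : ∀ c → F p c * (T c * T c) ≤ i * (B * B * ½) * E c
    fT²≤ c = begin
      w c * i * (T c * T c)                  ≡⟨ cong (λ z → w c * i * (z * z)) (∑-*ˡ B (λ s → p s c * ∣ x s c ∣)) ⟩
      w c * i * (B * A c * (B * A c))        ≡⟨ lemma₁ (w c) i (A c) ⟩
      i * (B * B * (w c * (A c * A c)))      ≤⟨ *-monoˡ-≤ 0≤i (*-monoˡ-≤ 0≤B² (*-monoˡ-≤ (weight-nonneg isM c) (A²≤PE c))) ⟩
      i * (B * B * (w c * (P c * E c)))      ≡⟨ cong (λ z → i * (B * B * z)) (*-assoc (w c) (P c) (E c)) ⟨
      i * (B * B * (w c * P c * E c))        ≤⟨ *-monoˡ-≤ 0≤i (*-monoˡ-≤ 0≤B² (*-monoʳ-≤ (0≤E c)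
                                                  (∏[1-p]*∑p≤½ (λ s → nonneg (isM s) c) (λ s → ≤1 (isM s) c)))) ⟩
      i * (B * B * (½ * E c))                ≡⟨ lemma₂ i (E c) ⟩
      i * (B * B * ½) * E c                  ∎
      where
      open ≤-Reasoning
      0≤B² : 0ℚ ≤ B * B
      0≤B² = from-yes (0ℚ ≤? B * B)
      lemma₁ : ∀ w i A → w * i * (+ 101 / 100 * A * (+ 101 / 100 * A)) ≡
               i * ((+ 101 / 100) * (+ 101 / 100) * (w * (A * A)))
      lemma₁ = solve-∀ ℚ-ring
      lemma₂ : ∀ i E → i * ((+ 101 / 100) * (+ 101 / 100) * (½ * E)) ≡ i * ((+ 101 / 100) * (+ 101 / 100) * ½) * E
      lemma₂ = solve-∀ ℚ-ring

    ∑E≤ : ∑ E ≤ fromℕ D * (r * r)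
    ∑E≤ = subst₂ _≤_ (∑-swap (λ s c → p s c * (x s c * x s c))) (∑-const D (r * r))
      (∑-mono λ s → Close.energy (close s))

    Di≤ : fromℕ D * i ≤ + 100 / 59
    Di≤ = *-inv-≤ (total-pos isM) (≤-trans D≤gap
      (*-monoˡ-≤ (from-yes (0ℚ ≤? + 100 / 59)) (gap≤total isM)))

    second-moment : + 2500 / 2401 * ∑ (λ c → F p c * (T c * T c)) ≤ σ * r * (σ * r)
    second-moment = begin
      + 2500 / 2401 * ∑ (λ c → F p c * (T c * T c))              ≤⟨ *-monoˡ-≤ (from-yes (0ℚ ≤? + 2500 / 2401)) (∑-mono fT²≤) ⟩
      + 2500 / 2401 * ∑ (λ c → i * (B * B * ½) * E c)            ≡⟨ cong (+ 2500 / 2401 *_) (∑-*ˡ (i * (B * B * ½)) E) ⟩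
      + 2500 / 2401 * (i * (B * B * ½) * ∑ E)                    ≤⟨ *-monoˡ-≤ (from-yes (0ℚ ≤? + 2500 / 2401))
                                                                     (*-monoˡ-≤ (*-nonneg 0≤i (from-yes (0ℚ ≤? B * B * ½))) ∑E≤) ⟩
      + 2500 / 2401 * (i * (B * B * ½) * (fromℕ D * (r * r)))    ≡⟨ lemma₁ i (fromℕ D) (r * r) ⟩
      fromℕ D * i * (K₀ * (r * r))                               ≤⟨ *-monoʳ-≤ (*-nonneg (from-yes (0ℚ ≤? K₀)) (0≤p*p r)) Di≤ ⟩
      + 100 / 59 * (K₀ * (r * r))                                ≡⟨ *-assoc (+ 100 / 59) K₀ (r * r) ⟨
      + 100 / 59 * K₀ * (r * r)                                  ≤⟨ *-monoʳ-≤ (0≤p*p r) (from-yes (+ 100 / 59 * K₀ ≤? σ * σ)) ⟩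
      σ * σ * (r * r)                                            ≡⟨ lemma₂ r ⟩
      σ * r * (σ * r)                                            ∎
      where
      open ≤-Reasoning
      K₀ = (+ 2500 / 2401) * ((+ 101 / 100) * (+ 101 / 100) * ½)
      lemma₁ : ∀ i D r² → + 2500 / 2401 * (i * ((+ 101 / 100) * (+ 101 / 100) * ½) * (D * r²)) ≡
               D * i * ((+ 2500 / 2401) * ((+ 101 / 100) * (+ 101 / 100) * ½) * r²)
      lemma₁ = solve-∀ ℚ-ring
      lemma₂ : ∀ r → (+ 19 / 20) * (+ 19 / 20) * (r * r) ≡ (+ 19 / 20) * r * ((+ 19 / 20) * r)
      lemma₂ = solve-∀ ℚ-ring

  -- Here closeness is created, not contracted: each child changes 1 - p by a relative amount of at
  -- most ν, so every weight changes by at most about D ν, and since `F` has mass 1 the energy is at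
  -- most (50/49 D ν)².
  interpolate : ∀ {κ ν r} {p p′ : Fin D → Message q} → 0ℚ ≤ κ → 0ℚ ≤ ν → κ + ν ≤ 1ℚ →
    fromℕ D * ν ≤ + 1 / 100 → + 50 / 49 * (fromℕ D * ν) ≤ r →
    (∀ s → IsMessage (p s)) → (∀ s → IsMessage (p′ s)) → (∀ s → EqualOrSmall (p s) (p′ s)) →
    Close r (F (λ s → mix κ (p s) (p′ s))) (F (λ s → mix (κ + ν) (p s) (p′ s)))
  interpolate {κ} {ν} {r} {p} {p′} 0≤κ 0≤ν κ+ν≤1 Dν≤ Dν≤r isM isM′ loose =
    small⇒Close (F-isMessage isM₁) (F-small isM₁) (proj₁ result) (proj₁ (proj₂ result))
      (≤-trans (proj₂ (proj₂ result)) second-moment)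
    where
    κ≤1 : κ ≤ 1ℚ
    κ≤1 = ≤-trans (≤-by ν 0≤ν (lemma κ ν)) κ+ν≤1
      where
      lemma : ∀ a b → a + b - a ≡ b
      lemma = solve-∀ ℚ-ring
    p₁ p₂ : Fin D → Message q
    p₁ s = mix κ (p s) (p′ s)
    p₂ s = mix (κ + ν) (p s) (p′ s)
    isM₁ : ∀ s → IsMessage (p₁ s)
    isM₁ s = mix-isMessage 0≤κ κ≤1 (isM s) (isM′ s)
    isM₂ : ∀ s → IsMessage (p₂ s)
    isM₂ s = mix-isMessage (+-nonneg 0≤κ 0≤ν) κ+ν≤1 (isM s) (isM′ s)

    ratio : ∀ {q} {p p′ : Message q} → IsMessage p → IsMessage p′ → EqualOrSmall p p′ → ∀ c →
            ∃[ s ] 1ℚ - mix (κ + ν) p p′ c ≡ (1ℚ - mix κ p p′ c) * (1ℚ - s) × ∣ s ∣ ≤ ν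
    -- Between equal messages `mix` does not move, so s = 0 works even where 1 - p = 0.
    ratio {p = p} {p′} m m′ (inj₁ p≗p′) c = 0ℚ ,
      subst (λ z → 1ℚ - (p c + (κ + ν) * (z - p c)) ≡ (1ℚ - (p c + κ * (z - p c))) * (1ℚ - 0ℚ)) (p≗p′ c) (lemma κ ν (p c)) ,
      0≤ν
      where
      lemma : ∀ κ ν a → 1ℚ - (a + (κ + ν) * (a - a)) ≡ (1ℚ - (a + κ * (a - a))) * (1ℚ - 0ℚ)
      lemma = solve-∀ ℚ-ring
    ratio {p = p} {p′} m m′ (inj₂ (sm , sm′)) c = ν * (p′ c - p c) * j , eq , bound
      where
      a = mix κ p p′ c
      j = inv (1ℚ - a)
      a-small = inv[1-p]≤ (mix-small 0≤κ κ≤1 sm sm′ c)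
      lemma : ∀ κ ν a b → 1ℚ - (a + (κ + ν) * (b - a)) ≡ 1ℚ - (a + κ * (b - a)) - ν * (b - a) * 1ℚ
      lemma = solve-∀ ℚ-ring
      lemma′ : ∀ z e j → z - e * (z * j) ≡ z * (1ℚ - e * j)
      lemma′ = solve-∀ ℚ-ring
      eq : 1ℚ - mix (κ + ν) p p′ c ≡ (1ℚ - a) * (1ℚ - ν * (p′ c - p c) * j)
      eq = trans (lemma κ ν (p c) (p′ c))
        (trans (cong (λ z → 1ℚ - a - ν * (p′ c - p c) * z) (sym (*-invʳ (proj₁ a-small))))
          (lemma′ (1ℚ - a) (ν * (p′ c - p c)) j))
      b-a≤ : ∀ {a b} → 0ℚ ≤ a → b ≤ + 1 / 101 → b - a ≤ + 1 / 101
      b-a≤ {a} {b} 0≤a b≤ = ≤-by (a + (+ 1 / 101 - b)) (+-nonneg 0≤a (0≤-diff b≤)) (eq′ a b)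
        where
        eq′ : ∀ a b → + 1 / 101 - (b - a) ≡ a + (+ 1 / 101 - b)
        eq′ = solve-∀ ℚ-ring
      ∣p′-p∣≤ : ∣ p′ c - p c ∣ ≤ + 1 / 101
      ∣p′-p∣≤ = ∣p∣≤ (b-a≤ (nonneg m c) (sm′ c))
        (subst (- (+ 1 / 101) ≤_) (flip (p c) (p′ c)) (neg-antimono-≤ (b-a≤ (nonneg m′ c) (sm c))))
        where
        flip : ∀ a b → - (a - b) ≡ b - a
        flip = solve-∀ ℚ-ring
      bound : ∣ ν * (p′ c - p c) * j ∣ ≤ ν
      bound = begin
        ∣ ν * (p′ c - p c) * j ∣         ≡⟨ ∣p*q∣≡∣p∣*∣q∣ (ν * (p′ c - p c)) j ⟩
        ∣ ν * (p′ c - p c) ∣ * ∣ j ∣     ≡⟨ cong₂ _*_ (∣p*q∣≡∣p∣*∣q∣ ν (p′ c - p c)) (0≤p⇒∣p∣≡p (inv-nonneg (proj₁ a-small))) ⟩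
        ∣ ν ∣ * ∣ p′ c - p c ∣ * j       ≡⟨ cong (λ z → z * ∣ p′ c - p c ∣ * j) (0≤p⇒∣p∣≡p 0≤ν) ⟩
        ν * ∣ p′ c - p c ∣ * j           ≤⟨ *-mono-≤ (*-nonneg 0≤ν (from-yes (0ℚ ≤? + 1 / 101))) (inv-nonneg (proj₁ a-small))
                                              (*-monoˡ-≤ 0≤ν ∣p′-p∣≤) (proj₂ a-small) ⟩
        ν * (+ 1 / 101) * (+ 101 / 100)  ≡⟨ *-assoc ν (+ 1 / 101) (+ 101 / 100) ⟩
        ν * (+ 1 / 100)                  ≤⟨ *-monoˡ-≤ 0≤ν (from-yes (+ 1 / 100 ≤? 1ℚ)) ⟩
        ν * 1ℚ                           ≡⟨ *-identityʳ ν ⟩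
        ν                                ∎
        where open ≤-Reasoning

    T : Fin q → ℚ
    T _ = ∑ {D} λ _ → ν

    T≡ : ∀ c → T c ≡ fromℕ D * ν
    T≡ _ = ∑-const D ν

    result = perturb isM₁ isM₂ (λ s c → proj₁ (ratio (isM s) (isM′ s) (loose s) c)) (λ _ _ → ν)
      (λ s c → proj₁ (proj₂ (ratio (isM s) (isM′ s) (loose s) c)))
      (λ s c → proj₂ (proj₂ (ratio (isM s) (isM′ s) (loose s) c)))
      (λ c → subst (_≤ + 1 / 100) (sym (T≡ c)) Dν≤)

    second-moment : + 2500 / 2401 * ∑ (λ c → F p₁ c * (T c * T c)) ≤ r * r
    second-moment = begin
      + 2500 / 2401 * ∑ (λ c → F p₁ c * (T c * T c))   ≡⟨ cong (+ 2500 / 2401 *_) (∑-cong λ c → cong (λ z → F p₁ c * (z * z)) (T≡ c)) ⟩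
      + 2500 / 2401 * ∑ (λ c → F p₁ c * (Dν * Dν))     ≡⟨ cong (+ 2500 / 2401 *_) (trans (∑-*ʳ (Dν * Dν) (F p₁)) (cong (_* (Dν * Dν)) (∑F≡1 isM₁))) ⟩
      + 2500 / 2401 * (1ℚ * (Dν * Dν))                 ≡⟨ lemma Dν ⟩
      + 50 / 49 * Dν * (+ 50 / 49 * Dν)                ≤⟨ *-mono-≤ (≤-trans 0≤Dν Dν≤r) 0≤Dν Dν≤r Dν≤r ⟩
      r * r                                            ∎
      where
      open ≤-Reasoning
      Dν = fromℕ D * ν
      0≤Dν : 0ℚ ≤ + 50 / 49 * Dν
      0≤Dν = *-nonneg (from-yes (0ℚ ≤? + 50 / 49)) (*-nonneg (fromℕ-nonneg D) 0≤ν)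
      lemma : ∀ z → + 2500 / 2401 * (1ℚ * (z * z)) ≡ + 50 / 49 * z * (+ 50 / 49 * z)
      lemma = solve-∀ ℚ-ring

  -- Chains of small perturbations

  N : ℕ
  N = 400 ℕ.* D ℕ.* D

  ν : ℚ
  ν = inv (fromℕ N)

  Nν≡1 : fromℕ N * ν ≡ 1ℚ
  Nν≡1 = *-invʳ (fromℕ-pos N)

  0≤ν : 0ℚ ≤ ν
  0≤ν = inv-nonneg (fromℕ-pos N)

  DDν≡ : fromℕ D * (fromℕ D * ν) ≡ + 1 / 400
  DDν≡ = trans (lemma (fromℕ D) ν) (cong (+ 1 / 400 *_)
    (trans (cong (_* ν) (sym (trans (fromℕ-* (400 ℕ.* D) D) (cong (_* fromℕ D) (fromℕ-* 400 D))))) Nν≡1))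
    where
    lemma : ∀ D ν → D * (D * ν) ≡ + 1 / 400 * ((+ 400 / 1) * D * D * ν)
    lemma = solve-∀ ℚ-ring

  1≤D : 1ℚ ≤ fromℕ D
  1≤D = fromℕ-mono-≤ {1} {D} (ℕ.s≤s ℕ.z≤n)

  0≤Dν : 0ℚ ≤ fromℕ D * ν
  0≤Dν = *-nonneg (fromℕ-nonneg D) 0≤ν

  Dν≤ : fromℕ D * ν ≤ + 1 / 100
  Dν≤ = ≤-trans (subst (fromℕ D * ν ≤_) DDν≡
    (subst (_≤ fromℕ D * (fromℕ D * ν)) (*-identityˡ (fromℕ D * ν)) (*-monoʳ-≤ 0≤Dν 1≤D)))
    (from-yes (+ 1 / 400 ≤? + 1 / 100))

  -- The factor 2 rounds up the 50/49 of `interpolate`. With N = 400 D² it gives D · `radius 0` =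
  -- 1/200, exactly the disturbance that `contract` admits.
  radius : ℕ → ℚ
  radius zero    = + 2 / 1 * (fromℕ D * ν)
  radius (suc m) = σ * radius m

  radius-nonneg : ∀ m → 0ℚ ≤ radius m
  radius-nonneg zero    = *-nonneg (from-yes (0ℚ ≤? + 2 / 1)) 0≤Dν
  radius-nonneg (suc m) = *-nonneg (from-yes (0ℚ ≤? σ)) (radius-nonneg m)

  D*radius≤ : ∀ m → fromℕ D * radius m ≤ + 1 / 200
  D*radius≤ zero = ≤-reflexive (trans (lemma (fromℕ D) (fromℕ D * ν)) (cong (+ 2 / 1 *_) DDν≡))
    where
    lemma : ∀ a b → a * (+ 2 / 1 * b) ≡ + 2 / 1 * (a * b)
    lemma = solve-∀ ℚ-ring
  D*radius≤ (suc m) = ≤-trans (*-monoˡ-≤ (fromℕ-nonneg D)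
    (subst (σ * radius m ≤_) (*-identityˡ (radius m)) (*-monoʳ-≤ (radius-nonneg m) (from-yes (σ ≤? 1ℚ)))))
    (D*radius≤ m)

  N*radius≡ : ∀ m → fromℕ N * radius m ≡ + 2 / 1 * fromℕ D * σ ^ m
  N*radius≡ zero = trans (lemma (fromℕ N) (fromℕ D) ν) (trans (cong (+ 2 / 1 * fromℕ D *_) Nν≡1) refl)
    where
    lemma : ∀ n d ν → n * (+ 2 / 1 * (d * ν)) ≡ + 2 / 1 * d * (n * ν)
    lemma = solve-∀ ℚ-ring
  N*radius≡ (suc m) = trans (lemma (fromℕ N) σ (radius m)) (trans (cong (σ *_) (N*radius≡ m))
    (lemma′ σ (+ 2 / 1 * fromℕ D) (σ ^ m)))
    where
    lemma : ∀ n s r → n * (s * r) ≡ s * (n * r)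
    lemma = solve-∀ ℚ-ring
    lemma′ : ∀ s d z → s * (d * z) ≡ d * (s * z)
    lemma′ = solve-∀ ℚ-ring

  -- All chains have the same length N, so that the chains of the children advance in lockstep and
  -- the parent obtains one link per step.
  record Chain (m : ℕ) (p p′ : Message q) : Set where
    field
      path      : ℕ → Message q
      start     : path 0 ≗ p
      end       : path N ≗ p′
      isMessage : ∀ {k} → k ℕ.≤ N → IsMessage (path k)
      close     : ∀ {k} → k ℕ.< N → Close (radius m) (path k) (path (suc k))

  open Chain

  Chain-refl : ∀ {m p p′} → IsMessage p → p ≗ p′ → Chain m p p′
  Chain-refl {p = p} isM p≗p′ = record
    { path      = λ _ → p
    ; start     = λ _ → refl
    ; end       = p≗p′
    ; isMessage = λ _ → isM
    ; close     = λ _ → Close-refl λ _ → refl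
    }

  -- The interpolation takes place one level below and `F` is applied to it, so every message on the
  -- path is small and every link falls under `interpolate`.
  Chain-base : ∀ {p p′ : Fin D → Message q} → (∀ s → IsMessage (p s)) → (∀ s → IsMessage (p′ s)) →
               (∀ s → EqualOrSmall (p s) (p′ s)) → Chain 0 (F p) (F p′)
  Chain-base {p} {p′} isM isM′ loose = record
    { path      = λ k → F (λ s → mix (fromℕ k * ν) (p s) (p′ s))
    ; start     = F-cong λ s c → trans (cong (λ z → mix z (p s) (p′ s) c) (*-zeroˡ ν)) (mix-0 (p s) (p′ s) c)
    ; end       = F-cong λ s c → trans (cong (λ z → mix z (p s) (p′ s) c) Nν≡1) (mix-1 (p s) (p′ s) c)
    ; isMessage = λ {k} k≤N → F-isMessage λ s → mix-isMessage (0≤kν k) (kν≤1 k≤N) (isM s) (isM′ s)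
    ; close     = λ {k} k<N → subst (λ z → Close (radius 0) (F (λ s → mix (fromℕ k * ν) (p s) (p′ s)))
                                        (F (λ s → mix z (p s) (p′ s)))) (suc-ν k)
                    (interpolate (0≤kν k) 0≤ν (subst (_≤ 1ℚ) (sym (suc-ν k)) (kν≤1 k<N)) Dν≤
                      (*-monoʳ-≤ 0≤Dν (from-yes (+ 50 / 49 ≤? + 2 / 1))) isM isM′ loose)
    }
    where
    0≤kν : ∀ k → 0ℚ ≤ fromℕ k * ν
    0≤kν k = *-nonneg (fromℕ-nonneg k) 0≤ν
    kν≤1 : ∀ {k} → k ℕ.≤ N → fromℕ k * ν ≤ 1ℚ
    kν≤1 {k} k≤N = subst (fromℕ k * ν ≤_) Nν≡1 (*-monoʳ-≤ 0≤ν (fromℕ-mono-≤ {k} {N} k≤N))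
    suc-ν : ∀ k → fromℕ k * ν + ν ≡ fromℕ (suc k) * ν
    suc-ν k = trans (lemma (fromℕ k) ν) (cong (_* ν) (sym (fromℕ-suc k)))
      where
      lemma : ∀ k ν → k * ν + ν ≡ (1ℚ + k) * ν
      lemma = solve-∀ ℚ-ring

  Chain-step : ∀ {m} {p p′ : Fin D → Message q} → (∀ s → Chain m (p s) (p′ s)) → Chain (suc m) (F p) (F p′)
  Chain-step {m} chains = record
    { path      = λ k → F (λ s → path (chains s) k)
    ; start     = F-cong λ s → start (chains s)
    ; end       = F-cong λ s → end (chains s)
    ; isMessage = λ k≤N → F-isMessage λ s → isMessage (chains s) k≤N
    ; close     = λ k<N → contract (radius-nonneg m) (D*radius≤ m)
                    (λ s → isMessage (chains s) (ℕ.<⇒≤ k<N)) (λ s → isMessage (chains s) k<N)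
                    (λ s → close (chains s) k<N)
    }

  -- The triangle inequality over the N links; N cancels against the ν in the radius.
  Chain⇒∣p-p′∣≤ : ∀ {m p p′} → Chain m p p′ → ∀ c → ∣ p c - p′ c ∣ ≤ + 2 / 1 * fromℕ D * σ ^ m
  Chain⇒∣p-p′∣≤ {m} {p} {p′} chain c = subst₂ _≤_
    (cong₂ (λ a b → ∣ a - b ∣) (start chain c) (end chain c)) (N*radius≡ m) (walk N ℕ.≤-refl)
    where
    walk : ∀ k → k ℕ.≤ N → ∣ path chain 0 c - path chain k c ∣ ≤ fromℕ k * radius m
    walk zero _ = ≤-reflexive (trans (cong ∣_∣ (+-inverseʳ (path chain 0 c))) (sym (*-zeroˡ (radius m))))
    walk (suc k) k<N = begin
      ∣ a - b ∣                    ≡⟨ cong ∣_∣ (lemma a z b) ⟩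
      ∣ (a - z) + (z - b) ∣        ≤⟨ ∣p+q∣≤∣p∣+∣q∣ (a - z) (z - b) ⟩
      ∣ a - z ∣ + ∣ z - b ∣        ≤⟨ +-mono-≤ (walk k (ℕ.<⇒≤ k<N))
                                       (Close⇒∣p-p′∣≤ (isMessage chain (ℕ.<⇒≤ k<N)) (close chain k<N) (radius-nonneg m) c) ⟩
      fromℕ k * radius m + radius m ≡⟨ lemma′ (fromℕ k) (radius m) ⟩
      (1ℚ + fromℕ k) * radius m    ≡⟨ cong (_* radius m) (fromℕ-suc k) ⟨
      fromℕ (suc k) * radius m     ∎
      where
      open ≤-Reasoning
      a = path chain 0 c
      z = path chain k c
      b = path chain (suc k) c
      lemma : ∀ a z b → a - b ≡ (a - z) + (z - b)
      lemma = solve-∀ ℚ-ring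
      lemma′ : ∀ k r → k * r + r ≡ (1ℚ + k) * r
      lemma′ = solve-∀ ℚ-ring

-- Messages on rooted trees

indicator : {A : Set} → Dec A → ℚ
indicator A? = if does A? then 1ℚ else 0ℚ

indicator-⇔ : {A B : Set} → A ⇔ B → (A? : Dec A) (B? : Dec B) → indicator A? ≡ indicator B?
indicator-⇔ A⇔B A? B? = cong (if_then 1ℚ else 0ℚ) (does-⇔ A⇔B A? B?)

indicator-× : {A B : Set} (A? : Dec A) (B? : Dec B) → indicator (A? ×-dec B?) ≡ indicator A? * indicator B?
indicator-× A? B? with does A?
... | true  = sym (*-identityˡ (indicator B?))
... | false = sym (*-zeroˡ (indicator B?))

indicator-¬ : {A : Set} (A? : Dec A) → indicator (¬? A?) ≡ 1ℚ - indicator A?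
indicator-¬ A? with does A?
... | true  = refl
... | false = refl

indicator-nonneg : {A : Set} (A? : Dec A) → 0ℚ ≤ indicator A?
indicator-nonneg A? with does A?
... | true  = from-yes (0ℚ ≤? 1ℚ)
... | false = ≤-refl

indicator-true : {A : Set} (A? : Dec A) → A → indicator A? ≡ 1ℚ
indicator-true A? a = cong (if_then 1ℚ else 0ℚ) (dec-true A? a)

δ : ∀ {n} → Fin n → Fin n → ℚ
δ a c = indicator (a ≟ᶠ c)

∑-0 : ∀ n → ∑ {n} (λ _ → 0ℚ) ≡ 0ℚ
∑-0 n = trans (∑-const n 0ℚ) (*-zeroʳ (fromℕ n))

∑-δ : ∀ {n} (a : Fin n) (g : Fin n → ℚ) → ∑ (λ c → δ a c * g c) ≡ g a
∑-δ {suc n} zero g = trans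
  (cong₂ _+_ (*-identityˡ (g zero)) (trans (∑-cong (λ c → *-zeroˡ (g (suc c)))) (∑-0 n)))
  (+-identityʳ (g zero))
∑-δ {suc n} (suc a) g = trans (cong₂ _+_ (*-zeroˡ (g zero)) (∑-δ a (λ c → g (suc c))))
  (+-identityˡ (g (suc a)))

δ-sym : ∀ {n} (a c : Fin n) → δ a c ≡ δ c a
δ-sym a c = indicator-⇔ (mk⇔ sym sym) (a ≟ᶠ c) (c ≟ᶠ a)

∑δ≡1 : ∀ {n} (a : Fin n) → ∑ (δ a) ≡ 1ℚ
∑δ≡1 a = trans (∑-cong (λ c → sym (*-identityʳ (δ a c)))) (∑-δ a (λ _ → 1ℚ))

δ-* : ∀ {n} (a c : Fin n) (g : Fin n → ℚ) → δ a c * g c ≡ g a * δ a c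
δ-* a c g with a ≟ᶠ c
... | yes refl = *-comm 1ℚ (g a)
... | no _     = trans (*-zeroˡ (g c)) (sym (*-zeroʳ (g a)))

∏-1 : ∀ n → ∏ {n} (λ _ → 1ℚ) ≡ 1ℚ
∏-1 zero    = refl
∏-1 (suc n) = trans (*-identityˡ (∏ {n} (λ _ → 1ℚ))) (∏-1 n)

-- Spreads a single factor over all indices, so that a change at one index becomes a pointwise
-- product.
∏-select : ∀ {n} (a : Fin n) x → ∏ (λ c → if does (c ≟ᶠ a) then x else 1ℚ) ≡ x
∏-select {suc n} zero x = trans (cong (x *_) (∏-1 n)) (*-identityʳ x)
∏-select {suc n} (suc a) x = trans (*-identityˡ _) (∏-select a x)

∏-indicator : ∀ {n} {P : Fin n → Set} (P? : ∀ i → Dec (P i)) (∀P? : Dec (∀ i → P i)) →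
              ∏ (λ i → indicator (P? i)) ≡ indicator ∀P?
∏-indicator {zero}  P? ∀P? = sym (indicator-true ∀P? (λ ()))
∏-indicator {suc n} P? ∀P? = begin
  indicator (P? zero) * ∏ (λ i → indicator (P? (suc i)))      ≡⟨ cong (indicator (P? zero) *_) (∏-indicator (λ i → P? (suc i)) ∀P?′) ⟩
  indicator (P? zero) * indicator ∀P?′                        ≡⟨ indicator-× (P? zero) ∀P?′ ⟨
  indicator (P? zero ×-dec ∀P?′)                              ≡⟨ indicator-⇔ (mk⇔ (λ { (p , ps) zero → p ; (p , ps) (suc i) → ps i })
                                                                                   (λ ps → ps zero , λ i → ps (suc i))) (P? zero ×-dec ∀P?′) ∀P? ⟩
  indicator ∀P?                                               ∎
  where
  open ≡-Reasoning
  ∀P?′ = all? (λ i → P? (suc i))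

-- The slots bound the number of children by D; ∅ is an empty slot.
data RootedTree (V : Set) (D : ℕ) : Set where
  ∅    : RootedTree V D
  node : V → (Fin D → RootedTree V D) → RootedTree V D

Pinning : Set → ℕ → Set
Pinning V q = V → Maybe (Fin q)

allows : ∀ {q} → Maybe (Fin q) → Fin q → ℚ
allows nothing  c = 1ℚ
allows (just a) c = δ a c

module _ {V : Set} {D q : ℕ} (π : Pinning V q) where

  messageAt : Maybe (Fin q) → (Fin D → Message q) → Message q
  messageAt nothing  p = F p
  messageAt (just a) p = δ a

  -- The value 0 on ∅ makes an empty slot contribute the factor 1 to F.
  message : RootedTree V D → Message q
  message ∅           = λ _ → 0ℚ
  message (node u ts) = messageAt (π u) (λ s → message (ts s))

  -- factor t c counts the colourings of t whose root avoids the colour c,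
  -- and count u ts c those of node u ts whose root has the colour c.
  factor : RootedTree V D → Fin q → ℚ
  factor ∅           c = 1ℚ
  factor (node u ts) c = ∑ λ c′ → (1ℚ - δ c c′) * (allows (π u) c′ * ∏ λ s → factor (ts s) c′)

  count : V → (Fin D → RootedTree V D) → Fin q → ℚ
  count u ts c = allows (π u) c * ∏ λ s → factor (ts s) c

-- Chains between the messages of two pinnings

AgreeTo : ∀ {V D q} → Pinning V q → Pinning V q → ℕ → RootedTree V D → Set
AgreeTo π π′ m       ∅           = ⊤
AgreeTo π π′ zero    (node u ts) = π u ≡ π′ u
AgreeTo π π′ (suc m) (node u ts) = π u ≡ π′ u × (∀ s → AgreeTo π π′ m (ts s))

module TreeMessages (d q : ℕ)
  (101≤gap : + 101 / 1 ≤ fromℕ q - fromℕ (suc d))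
  (D≤gap : fromℕ (suc d) ≤ + 100 / 59 * (fromℕ q - fromℕ (suc d)))
  {V : Set} where

  private
    D : ℕ
    D = suc d

  open Recursion D q 101≤gap D≤gap
  open Contraction d q 101≤gap D≤gap

  private
    Tree = RootedTree V D

  δ-isMessage : (a : Fin q) → IsMessage (δ a)
  δ-isMessage a = record
    { nonneg = λ c → indicator-nonneg (a ≟ᶠ c)
    ; ∑≤1    = ≤-reflexive (∑δ≡1 a)
    }

  0-isMessage : IsMessage {q} (λ _ → 0ℚ)
  0-isMessage = record { nonneg = λ _ → ≤-refl ; ∑≤1 = ≤-trans (≤-reflexive (∑-0 q)) (from-yes (0ℚ ≤? 1ℚ)) }

  module _ (π : Pinning V q) where

    messageAt-isMessage : ∀ m {p : Fin D → Message q} → (∀ s → IsMessage (p s)) → IsMessage (messageAt π m p)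
    messageAt-isMessage nothing  isM = F-isMessage isM
    messageAt-isMessage (just a) isM = δ-isMessage a

    message-isMessage : (t : Tree) → IsMessage (message π t)
    message-isMessage ∅           = 0-isMessage
    message-isMessage (node u ts) = messageAt-isMessage (π u) (λ s → message-isMessage (ts s))

    ∑message≡1 : ∀ u ts → ∑ (message {D = D} π (node u ts)) ≡ 1ℚ
    ∑message≡1 u ts with π u
    ... | nothing = ∑F≡1 (λ s → message-isMessage (ts s))
    ... | just a  = ∑δ≡1 a

    private
      normalise : ∀ m {p g : Fin D → Message q} → (∀ s → IsMessage (p s)) →
                  (∀ s → ∃[ κ ] (∀ c → g s c ≡ κ * (1ℚ - p s c))) →
                  ∃[ κ ] (∀ c → allows m c * ∏ (λ s → g s c) ≡ κ * messageAt π m p c)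
      normalise nothing {p} {g} isM scales = ∏ (λ s → proj₁ (scales s)) * total p , λ c → begin
        1ℚ * ∏ (λ s → g s c)                          ≡⟨ *-identityˡ _ ⟩
        ∏ (λ s → g s c)                               ≡⟨ ∏-cong (λ s → proj₂ (scales s) c) ⟩
        ∏ (λ s → proj₁ (scales s) * (1ℚ - p s c))     ≡⟨ ∏-* (λ s → proj₁ (scales s)) (λ s → 1ℚ - p s c) ⟩
        n * weight p c                                ≡⟨ cong (_* weight p c) (*-identityʳ n) ⟨
        n * 1ℚ * weight p c                           ≡⟨ cong (λ z → n * z * weight p c) (*-invʳ (total-pos isM)) ⟨
        n * (total p * inv (total p)) * weight p c    ≡⟨ lemma n (total p) (inv (total p)) (weight p c) ⟩
        n * total p * (weight p c * inv (total p))    ∎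
        where
        open ≡-Reasoning
        n = ∏ (λ s → proj₁ (scales s))
        lemma : ∀ n t i w → n * (t * i) * w ≡ n * t * (w * i)
        lemma = solve-∀ ℚ-ring
      normalise (just a) {p} {g} isM scales = ∏ (λ s → g s a) , λ c → δ-* a c (λ c → ∏ (λ s → g s c))

    -- Proportionality suffices: the constant is the same for all colours and cancels in a
    -- conditional probability. It may be 0, when the pinning has no proper extension, whereas
    -- messages exist for every pinning.
    count-scale : ∀ u (ts : Fin D → Tree) → ∃[ κ ] (∀ c → count π u ts c ≡ κ * message π (node u ts) c)
    -- Avoiding c leaves the mass ∑ p - p(c), and the message of a nonempty tree has mass 1.
    factor-scale : (t : Tree) → ∃[ κ ] (∀ c → factor π t c ≡ κ * (1ℚ - message π t c))

    count-scale u ts = normalise (π u) (λ s → message-isMessage (ts s)) (λ s → factor-scale (ts s))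

    factor-scale ∅ = 1ℚ , λ _ → refl
    factor-scale (node u ts) = κ , λ c → begin
      ∑ (λ c′ → (1ℚ - δ c c′) * count π u ts c′)       ≡⟨ ∑-cong (λ c′ → trans (cong ((1ℚ - δ c c′) *_) (proj₂ scale c′)) (lemma (δ c c′) κ (p c′))) ⟩
      ∑ (λ c′ → κ * p c′ - δ c c′ * (κ * p c′))        ≡⟨ ∑-- (λ c′ → κ * p c′) (λ c′ → δ c c′ * (κ * p c′)) ⟩
      ∑ (λ c′ → κ * p c′) - ∑ (λ c′ → δ c c′ * (κ * p c′)) ≡⟨ cong₂ _-_ (∑-*ˡ κ p) (∑-δ c (λ c′ → κ * p c′)) ⟩
      κ * ∑ p - κ * p c                                ≡⟨ cong (λ z → κ * z - κ * p c) (∑message≡1 u ts) ⟩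
      κ * 1ℚ - κ * p c                                 ≡⟨ lemma′ κ (p c) ⟩
      κ * (1ℚ - p c)                                   ∎
      where
      open ≡-Reasoning
      p = message π (node u ts)
      scale = count-scale u ts
      κ = proj₁ scale
      lemma : ∀ d n p → (1ℚ - d) * (n * p) ≡ n * p - d * (n * p)
      lemma = solve-∀ ℚ-ring
      lemma′ : ∀ n p → n * 1ℚ - n * p ≡ n * (1ℚ - p)
      lemma′ = solve-∀ ℚ-ring

  module _ (π π′ : Pinning V q) where

    -- Whatever lies below it, an unpinned vertex sends a value of `F`, and these are small.
    EqualOrSmall-message : (t : Tree) → AgreeTo π π′ 0 t → EqualOrSmall (message π t) (message π′ t)
    EqualOrSmall-message ∅ _ = inj₁ λ _ → refl
    EqualOrSmall-message (node u ts) eq with π u | π′ u | eq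
    ... | nothing | _ | refl = inj₂ (F-small (λ s → message-isMessage π (ts s)) , F-small (λ s → message-isMessage π′ (ts s)))
    ... | just a  | _ | refl = inj₁ λ _ → refl

    -- The pins agree on the levels 0 to m + 1. An unpinned vertex at level m starts a chain, since
    -- its children are pinned alike or send small messages, and each of the m levels above
    -- contracts it once. A pinned vertex on the way cuts off everything below it.
    Chain-message : ∀ m (t : Tree) → AgreeTo π π′ (suc m) t → Chain m (message π t) (message π′ t)
    Chain-message m ∅ _ = Chain-refl 0-isMessage λ _ → refl
    Chain-message m (node u ts) (eq , agree) with π u | π′ u | eq
    Chain-message m (node u ts) (eq , agree) | just a | _ | refl = Chain-refl (δ-isMessage a) λ _ → refl
    Chain-message zero (node u ts) (eq , agree) | nothing | _ | refl =
      Chain-base (λ s → message-isMessage π (ts s)) (λ s → message-isMessage π′ (ts s))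
        (λ s → EqualOrSmall-message (ts s) (agree s))
    Chain-message (suc m) (node u ts) (eq , agree) | nothing | _ | refl =
      Chain-step λ s → Chain-message m (ts s) (agree s)

∏-remove : ∀ {n} (i : Fin (suc n)) (f : Fin (suc n) → ℚ) → ∏ f ≡ f i * ∏ (λ j → f (punchIn i j))
∏-remove i f = Product.sum-remove {i = i} f

-- Sums over all maps Fin n → Fin q

module _ {q : ℕ} where

  ∑maps : ∀ n → ((Fin n → Fin q) → ℚ) → ℚ
  ∑maps zero    g = g λ ()
  ∑maps (suc n) g = ∑ λ c → ∑maps n λ τ → g (c ∷ᶠ τ)

  -- Pointwise equal maps need not be identical, so a summand has to respect ≗ before coordinates
  -- are reordered or maps are decoded from numbers.
  Extensional : ∀ {n} → ((Fin n → Fin q) → ℚ) → Set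
  Extensional g = ∀ τ τ′ → τ ≗ τ′ → g τ ≡ g τ′

  ∑maps-cong : ∀ n {g h : (Fin n → Fin q) → ℚ} → (∀ τ → g τ ≡ h τ) → ∑maps n g ≡ ∑maps n h
  ∑maps-cong zero    g≡h = g≡h _
  ∑maps-cong (suc n) g≡h = ∑-cong λ c → ∑maps-cong n λ τ → g≡h (c ∷ᶠ τ)

  ∑maps-*ˡ : ∀ n k (g : (Fin n → Fin q) → ℚ) → ∑maps n (λ τ → k * g τ) ≡ k * ∑maps n g
  ∑maps-*ˡ zero    k g = refl
  ∑maps-*ˡ (suc n) k g = trans (∑-cong λ c → ∑maps-*ˡ n k λ τ → g (c ∷ᶠ τ))
    (∑-*ˡ k λ c → ∑maps n λ τ → g (c ∷ᶠ τ))

  ∑maps-∑ : ∀ n {m} (g : Fin m → (Fin n → Fin q) → ℚ) → ∑ (λ i → ∑maps n (g i)) ≡ ∑maps n (λ τ → ∑ λ i → g i τ)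
  ∑maps-∑ zero    g = refl
  ∑maps-∑ (suc n) g = trans (∑-swap λ i c → ∑maps n λ τ → g i (c ∷ᶠ τ))
    (∑-cong λ c → ∑maps-∑ n λ i τ → g i (c ∷ᶠ τ))

  ∷ᶠ-cong : ∀ {n} (c : Fin q) {τ τ′ : Fin n → Fin q} → τ ≗ τ′ → c ∷ᶠ τ ≗ c ∷ᶠ τ′
  ∷ᶠ-cong c τ≗τ′ zero    = refl
  ∷ᶠ-cong c τ≗τ′ (suc i) = τ≗τ′ i

  -- Fubini for the coordinate u: the colour of the vertex to be eliminated becomes the innermost
  -- sum.
  ∑maps-insertAt : ∀ n (u : Fin (suc n)) {g : (Fin (suc n) → Fin q) → ℚ} → Extensional g →
                   ∑maps (suc n) g ≡ ∑maps n (λ τ → ∑ λ c → g (insertAt τ u c))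
  ∑maps-insertAt n u {g} ext = trans (insert-outer n u ext) (∑maps-∑ n λ c τ → g (insertAt τ u c))
    where
    insert-outer : ∀ n (u : Fin (suc n)) {g : (Fin (suc n) → Fin q) → ℚ} → Extensional g →
                   ∑maps (suc n) g ≡ ∑ (λ c → ∑maps n λ τ → g (insertAt τ u c))
    insert-outer n zero ext = ∑-cong λ c → ∑maps-cong n λ τ → ext (c ∷ᶠ τ) (insertAt τ zero c) λ { zero → refl ; (suc i) → refl }
    insert-outer (suc n) (suc u) {g} ext = begin
      ∑ (λ c₀ → ∑maps (suc n) λ τ → g (c₀ ∷ᶠ τ))
        ≡⟨ ∑-cong (λ c₀ → insert-outer n u λ τ τ′ eq → ext (c₀ ∷ᶠ τ) (c₀ ∷ᶠ τ′) (∷ᶠ-cong c₀ eq)) ⟩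
      ∑ (λ c₀ → ∑ λ c → ∑maps n λ τ → g (c₀ ∷ᶠ insertAt τ u c))
        ≡⟨ ∑-swap (λ c₀ c → ∑maps n λ τ → g (c₀ ∷ᶠ insertAt τ u c)) ⟩
      ∑ (λ c → ∑ λ c₀ → ∑maps n λ τ → g (c₀ ∷ᶠ insertAt τ u c))
        ≡⟨ ∑-cong (λ c → ∑-cong λ c₀ → ∑maps-cong n λ τ → ext (c₀ ∷ᶠ insertAt τ u c) (insertAt (c₀ ∷ᶠ τ) (suc u) c) λ { zero → refl ; (suc i) → refl }) ⟩
      ∑ (λ c → ∑ λ c₀ → ∑maps n λ τ → g (insertAt (c₀ ∷ᶠ τ) (suc u) c)) ∎
      where open ≡-Reasoning

-- Elimination of the vertices of a forest

argmax : ∀ {n} (f : Fin (suc n) → ℕ) → ∃[ i ] (∀ j → f j ℕ.≤ f i)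
argmax {zero}  f = zero , λ { zero → ℕ.≤-refl }
argmax {suc n} f with argmax (λ i → f (suc i))
... | i , max with ℕ.≤-total (f zero) (f (suc i))
...   | inj₁ f0≤fi = suc i , λ { zero → f0≤fi ; (suc j) → max j }
...   | inj₂ fi≤f0 = zero , λ { zero → ℕ.≤-refl ; (suc j) → ℕ.≤-trans (max j) fi≤f0 }

data View {n} (u : Fin (suc n)) : Fin (suc n) → Set where
  same  : View u u
  other : ∀ j → View u (punchIn u j)

view : ∀ {n} (u i : Fin (suc n)) → View u i
view u i with u ≟ᶠ i
... | yes refl = same
... | no u≢i   = subst (View u) (punchIn-punchOut u≢i) (other (punchOut u≢i))

-- Summing out the vertices of a forest one at a time, in the order of
-- decreasing rank; a vertex has at most one neighbour of smaller or equal
-- rank, to which its subtree is then attached.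
module Elimination {V : Set} (G : Graph V) {D q : ℕ}
  (slot : V → V → Fin D)
  (slot-injective : ∀ {u w w′} → Graph._~_ G u w → Graph._~_ G u w′ → slot u w ≡ slot u w′ → w ≡ w′)
  (rank : V → ℕ)
  (parent-unique : ∀ {u w w′} → Graph._~_ G u w → Graph._~_ G u w′ →
                   rank w ℕ.≤ rank u → rank w′ ℕ.≤ rank u → w ≡ w′)
  where

  open Graph G

  Tree : Set
  Tree = RootedTree V D

  RootAdjacent : V → Tree → Set
  RootAdjacent u ∅          = ⊤
  RootAdjacent u (node w _) = u ~ w

  -- Edges of the rooted tree are edges of the graph, so a vertex at depth k is reached from the
  -- root by a walk of length k; this is how depth is compared with distance.
  Valid : Tree → Set
  Valid ∅           = ⊤
  Valid (node u ts) = ∀ s → RootAdjacent u (ts s) × Valid (ts s)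

  attach : (Fin D → Tree) → Fin D → Tree → Fin D → Tree
  attach ts s₀ t s = if does (s ≟ᶠ s₀) then t else ts s

  attach-other : ∀ ts {s₀} t {s} → s ≢ s₀ → attach ts s₀ t s ≡ ts s
  attach-other ts {s₀} t {s} s≢s₀ = cong (if_then t else ts s) (dec-false (s ≟ᶠ s₀) s≢s₀)

  -- An empty slot contributes the factor 1, so filling it multiplies the product by the factor of
  -- the new tree.
  count-attach : ∀ (π : Pinning V q) u ts s₀ t c → ts s₀ ≡ ∅ →
                 count π u (attach ts s₀ t) c ≡ count π u ts c * factor π t c
  count-attach π u ts s₀ t c empty = begin
    a * ∏ (λ s → factor π (attach ts s₀ t s) c)
      ≡⟨ cong (a *_) (∏-cong split) ⟩
    a * ∏ (λ s → factor π (ts s) c * (if does (s ≟ᶠ s₀) then factor π t c else 1ℚ))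
      ≡⟨ cong (a *_) (∏-* (λ s → factor π (ts s) c) (λ s → if does (s ≟ᶠ s₀) then factor π t c else 1ℚ)) ⟩
    a * (∏ (λ s → factor π (ts s) c) * ∏ (λ s → if does (s ≟ᶠ s₀) then factor π t c else 1ℚ))
      ≡⟨ cong (λ z → a * (∏ (λ s → factor π (ts s) c) * z)) (∏-select s₀ (factor π t c)) ⟩
    a * (∏ (λ s → factor π (ts s) c) * factor π t c)
      ≡⟨ *-assoc a _ _ ⟨
    a * ∏ (λ s → factor π (ts s) c) * factor π t c ∎
    where
    open ≡-Reasoning
    a = allows (π u) c
    split : ∀ s → factor π (attach ts s₀ t s) c ≡ factor π (ts s) c * (if does (s ≟ᶠ s₀) then factor π t c else 1ℚ)
    split s with s ≟ᶠ s₀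
    ... | yes refl = sym (trans (cong (λ z → factor π z c * factor π t c) empty) (*-identityˡ (factor π t c)))
    ... | no _     = sym (*-identityʳ (factor π (ts s) c))

  ProperOn : ∀ {n} → (Fin n → V) → (Fin n → Fin q) → Set
  ProperOn lab τ = ∀ i j → lab i ~ lab j → τ i ≢ τ j

  properOn? : ∀ {n} (lab : Fin n → V) → Decidable (ProperOn lab)
  properOn? lab τ = all? λ i → all? λ j → (lab i ~? lab j) →-dec ¬? (τ i ≟ᶠ τ j)

  ProperOn-resp : ∀ {n} {lab : Fin n → V} {τ τ′} → τ ≗ τ′ → ProperOn lab τ → ProperOn lab τ′
  ProperOn-resp eq pr i j adj = subst₂ _≢_ (eq i) (eq j) (pr i j adj)

  -- The summand at an intermediate stage: τ colours the vertices that remain, each of them carries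
  -- in `kids` the trees of eliminated vertices, and δ singles out the colour c at the target v.
  weightOf : ∀ {n} (lab : Fin n → V) (kids : Fin n → Fin D → Tree) → Pinning V q →
             Fin n → Fin q → (Fin n → Fin q) → ℚ
  weightOf lab kids π v c τ = δ c (τ v) * indicator (properOn? lab τ) * ∏ λ i → count π (lab i) (kids i) (τ i)

  weightOf-ext : ∀ {n} (lab : Fin n → V) kids π v c → Extensional (weightOf lab kids π v c)
  weightOf-ext lab kids π v c τ τ′ eq = cong₂ _*_
    (cong₂ _*_ (cong (δ c) (eq v))
      (indicator-⇔ (mk⇔ (ProperOn-resp eq) (ProperOn-resp λ i → sym (eq i))) (properOn? lab τ) (properOn? lab τ′)))
    (∏-cong λ i → cong (count π (lab i) (kids i)) (eq i))

  module _ {n} (lab : Fin (suc n) → V) (u : Fin (suc n)) where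

    private
      lab′ : Fin n → V
      lab′ j = lab (punchIn u j)

    proper-insert-isolated : (∀ j → ¬ lab u ~ lab′ j) → ∀ τ c →
      indicator (properOn? lab (insertAt τ u c)) ≡ indicator (properOn? lab′ τ)
    proper-insert-isolated isolated τ c = indicator-⇔ (mk⇔ to from) (properOn? lab (insertAt τ u c)) (properOn? lab′ τ)
      where
      to : ProperOn lab (insertAt τ u c) → ProperOn lab′ τ
      to pr i j adj = subst₂ _≢_ (insertAt-punchIn τ u c i) (insertAt-punchIn τ u c j) (pr _ _ adj)
      from : ProperOn lab′ τ → ProperOn lab (insertAt τ u c)
      from pr i j adj with view u i | view u j
      ... | same     | same     = contradiction adj (~-irrefl refl)
      ... | same     | other j′ = contradiction adj (isolated j′)
      ... | other i′ | same     = contradiction (~-sym adj) (isolated i′)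
      ... | other i′ | other j′ = subst₂ _≢_ (sym (insertAt-punchIn τ u c i′)) (sym (insertAt-punchIn τ u c j′)) (pr i′ j′ adj)

    -- Only the neighbour w constrains the colour of u; the resulting 1 - δ is the one in the
    -- definition of `factor`.
    proper-insert-leaf : ∀ {w} → lab u ~ lab′ w → (∀ j → lab u ~ lab′ j → j ≡ w) → ∀ τ c →
      indicator (properOn? lab (insertAt τ u c)) ≡ indicator (properOn? lab′ τ) * (1ℚ - δ (τ w) c)
    proper-insert-leaf {w} u~w unique τ c = trans
      (indicator-⇔ (mk⇔ to from) (properOn? lab (insertAt τ u c)) (properOn? lab′ τ ×-dec ¬? (τ w ≟ᶠ c)))
      (trans (indicator-× (properOn? lab′ τ) (¬? (τ w ≟ᶠ c)))
        (cong (indicator (properOn? lab′ τ) *_) (indicator-¬ (τ w ≟ᶠ c))))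
      where
      to : ProperOn lab (insertAt τ u c) → ProperOn lab′ τ × τ w ≢ c
      to pr = (λ i j adj → subst₂ _≢_ (insertAt-punchIn τ u c i) (insertAt-punchIn τ u c j) (pr _ _ adj))
            , subst₂ _≢_ (insertAt-punchIn τ u c w) (insertAt-lookup τ u c) (pr _ _ (~-sym u~w))
      from : ProperOn lab′ τ × τ w ≢ c → ProperOn lab (insertAt τ u c)
      from (pr , τw≢c) i j adj with view u i | view u j
      ... | same     | same     = contradiction adj (~-irrefl refl)
      ... | same     | other j′ = subst₂ _≢_ (sym (insertAt-lookup τ u c)) (sym (insertAt-punchIn τ u c j′))
              (λ eq → τw≢c (trans (cong τ (sym (unique j′ adj))) (sym eq)))
      ... | other i′ | same     = subst₂ _≢_ (sym (insertAt-punchIn τ u c i′)) (sym (insertAt-lookup τ u c))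
              (λ eq → τw≢c (trans (cong τ (sym (unique i′ (~-sym adj)))) eq))
      ... | other i′ | other j′ = subst₂ _≢_ (sym (insertAt-punchIn τ u c i′)) (sym (insertAt-punchIn τ u c j′)) (pr i′ j′ adj)

  module _ {n} (lab : Fin (suc n) → V) (kids : Fin (suc n) → Fin D → Tree) (π : Pinning V q)
           (u : Fin (suc n)) (v : Fin n) (c : Fin q) (τ : Fin n → Fin q) where

    private
      lab′ : Fin n → V
      lab′ j = lab (punchIn u j)
      kids′ : Fin n → Fin D → Tree
      kids′ j = kids (punchIn u j)
      rest = ∏ λ j → count π (lab′ j) (kids′ j) (τ j)

    weightOf-insert : ∀ a x → indicator (properOn? lab (insertAt τ u a)) ≡ indicator (properOn? lab′ τ) * x →
      weightOf lab kids π (punchIn u v) c (insertAt τ u a) ≡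
      weightOf lab′ kids′ π v c τ * (x * count π (lab u) (kids u) a)
    weightOf-insert a x eq = trans
      (cong₂ _*_ (cong₂ _*_ (cong (δ c) (insertAt-punchIn τ u a v)) eq)
        (trans (∏-remove u (λ i → count π (lab i) (kids i) (insertAt τ u a i))) (cong₂ _*_ (cong (count π (lab u) (kids u)) (insertAt-lookup τ u a))
          (∏-cong λ j → cong (count π (lab′ j) (kids′ j)) (insertAt-punchIn τ u a j)))))
      (lemma (δ c (τ v)) (indicator (properOn? lab′ τ)) x (count π (lab u) (kids u) a) rest)
      where
      lemma : ∀ d i x k r → d * (i * x) * (k * r) ≡ d * i * r * (x * k)
      lemma = solve-∀ ℚ-ring

    -- The colour of u decouples from the rest, and summing over it gives a constant independent of
    -- c.
    ∑weightOf-isolated : (∀ j → ¬ lab u ~ lab′ j) →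
      ∑ (λ a → weightOf lab kids π (punchIn u v) c (insertAt τ u a)) ≡
      ∑ (count π (lab u) (kids u)) * weightOf lab′ kids′ π v c τ
    ∑weightOf-isolated isolated = begin
      ∑ (λ a → weightOf lab kids π (punchIn u v) c (insertAt τ u a))
        ≡⟨ ∑-cong (λ a → weightOf-insert a 1ℚ (trans (proper-insert-isolated lab u isolated τ a) (sym (*-identityʳ _)))) ⟩
      ∑ (λ a → W * (1ℚ * count π (lab u) (kids u) a))
        ≡⟨ ∑-*ˡ W (λ a → 1ℚ * count π (lab u) (kids u) a) ⟩
      W * ∑ (λ a → 1ℚ * count π (lab u) (kids u) a)
        ≡⟨ cong (W *_) (∑-cong λ a → *-identityˡ (count π (lab u) (kids u) a)) ⟩
      W * ∑ (count π (lab u) (kids u))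
        ≡⟨ *-comm W _ ⟩
      ∑ (count π (lab u) (kids u)) * W ∎
      where
      open ≡-Reasoning
      W = weightOf lab′ kids′ π v c τ

    grow : Fin n → Fin n → Fin D → Tree
    grow w j = if does (j ≟ᶠ w) then attach (kids′ j) (slot (lab′ w) (lab u)) (node (lab u) (kids u)) else kids′ j

    ∑weightOf-leaf : ∀ {w} → lab u ~ lab′ w → (∀ j → lab u ~ lab′ j → j ≡ w) →
      kids′ w (slot (lab′ w) (lab u)) ≡ ∅ →
      ∑ (λ a → weightOf lab kids π (punchIn u v) c (insertAt τ u a)) ≡ weightOf lab′ (grow w) π v c τ
    ∑weightOf-leaf {w} u~w unique empty = begin
      ∑ (λ a → weightOf lab kids π (punchIn u v) c (insertAt τ u a))
        ≡⟨ ∑-cong (λ a → weightOf-insert a (1ℚ - δ (τ w) a) (proper-insert-leaf lab u u~w unique τ a)) ⟩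
      ∑ (λ a → d * i * rest * ((1ℚ - δ (τ w) a) * count π (lab u) (kids u) a))
        ≡⟨ ∑-*ˡ (d * i * rest) (λ a → (1ℚ - δ (τ w) a) * count π (lab u) (kids u) a) ⟩
      d * i * rest * factor π t (τ w)
        ≡⟨ *-assoc (d * i) rest (factor π t (τ w)) ⟩
      d * i * (rest * factor π t (τ w))
        ≡⟨ cong (λ z → d * i * (rest * z)) (∏-select w (factor π t (τ w))) ⟨
      d * i * (rest * ∏ (λ j → if does (j ≟ᶠ w) then factor π t (τ w) else 1ℚ))
        ≡⟨ cong (d * i *_) (∏-* (λ j → count π (lab′ j) (kids′ j) (τ j)) (λ j → if does (j ≟ᶠ w) then factor π t (τ w) else 1ℚ)) ⟨
      d * i * ∏ (λ j → count π (lab′ j) (kids′ j) (τ j) * (if does (j ≟ᶠ w) then factor π t (τ w) else 1ℚ))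
        ≡⟨ cong (d * i *_) (∏-cong split) ⟨
      d * i * ∏ (λ j → count π (lab′ j) (grow w j) (τ j)) ∎
      where
      open ≡-Reasoning
      d = δ c (τ v)
      i = indicator (properOn? lab′ τ)
      t = node (lab u) (kids u)
      split : ∀ j → count π (lab′ j) (grow w j) (τ j) ≡
              count π (lab′ j) (kids′ j) (τ j) * (if does (j ≟ᶠ w) then factor π t (τ w) else 1ℚ)
      split j with j ≟ᶠ w
      ... | yes refl = count-attach π (lab′ w) (kids′ w) (slot (lab′ w) (lab u)) t (τ w) empty
      ... | no _     = sym (*-identityʳ (count π (lab′ j) (kids′ j) (τ j)))

  -- The invariant of the elimination: the slot towards a remaining neighbour is still free to
  -- receive its subtree.
  EmptySlots : ∀ {n} → (Fin n → V) → (Fin n → Fin D → Tree) → Set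
  EmptySlots lab kids = ∀ i j → lab i ~ lab j → kids i (slot (lab i) (lab j)) ≡ ∅

  -- The tree is chosen before the pinning, so that two boundary conditions are compared on the same
  -- tree; only κ depends on π. Strict minimality of the rank at v keeps v to the end.
  eliminate : ∀ {n} (lab : Fin (suc n) → V) → (∀ {i j} → lab i ≡ lab j → i ≡ j) →
    (v : Fin (suc n)) → (∀ i → i ≢ v → rank (lab v) ℕ.< rank (lab i)) →
    (kids : Fin (suc n) → Fin D → Tree) → EmptySlots lab kids → (∀ i → Valid (node (lab i) (kids i))) →
    ∃[ ts ] Valid (node (lab v) ts) ×
      (∀ π → ∃[ κ ] (∀ c → ∑maps (suc n) (weightOf lab kids π v c) ≡ κ * count π (lab v) ts c))
  eliminate {zero} lab inj zero v-min kids empty valid = kids zero , valid zero , λ π → 1ℚ , λ c → begin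
    ∑ (λ a → ∑maps 0 (λ τ → weightOf lab kids π zero c (a ∷ᶠ τ)))
      ≡⟨ ∑-cong (λ a → trans (cong (λ z → δ c a * z * (count π (lab zero) (kids zero) a * 1ℚ))
           (indicator-true (properOn? lab (a ∷ᶠ λ ())) λ { zero zero adj → contradiction adj (~-irrefl refl) }))
           (lemma (δ c a) (count π (lab zero) (kids zero) a))) ⟩
    ∑ (λ a → δ c a * count π (lab zero) (kids zero) a)
      ≡⟨ ∑-δ c (count π (lab zero) (kids zero)) ⟩
    count π (lab zero) (kids zero) c
      ≡⟨ *-identityˡ _ ⟨
    1ℚ * count π (lab zero) (kids zero) c ∎
    where
    open ≡-Reasoning
    lemma : ∀ d k → d * 1ℚ * (k * 1ℚ) ≡ d * k
    lemma = solve-∀ ℚ-ring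
  eliminate {suc n} lab inj v v-min kids empty valid with argmax (λ i → rank (lab i))
  ... | u , u-max with view u v
  ...   | same = contradiction (u-max (punchIn v zero)) (ℕ.<⇒≱ (v-min (punchIn v zero) (punchInᵢ≢i v zero)))
  ...   | other v′ with any? (λ j → lab u ~? lab (punchIn u j))
  ...     | no none = ts , ts-valid , λ π → K π * proj₁ (counts π) , λ c → begin
    ∑maps (suc (suc n)) (weightOf lab kids π (punchIn u v′) c)
      ≡⟨ ∑maps-insertAt (suc n) u (weightOf-ext lab kids π (punchIn u v′) c) ⟩
    ∑maps (suc n) (λ τ → ∑ λ a → weightOf lab kids π (punchIn u v′) c (insertAt τ u a))
      ≡⟨ ∑maps-cong (suc n) (λ τ → ∑weightOf-isolated lab kids π u v′ c τ λ j adj → none (j , adj)) ⟩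
    ∑maps (suc n) (λ τ → K π * weightOf lab′ kids′ π v′ c τ)
      ≡⟨ ∑maps-*ˡ (suc n) (K π) (weightOf lab′ kids′ π v′ c) ⟩
    K π * ∑maps (suc n) (weightOf lab′ kids′ π v′ c)
      ≡⟨ cong (K π *_) (proj₂ (counts π) c) ⟩
    K π * (proj₁ (counts π) * count π (lab′ v′) ts c)
      ≡⟨ *-assoc (K π) (proj₁ (counts π)) (count π (lab′ v′) ts c) ⟨
    K π * proj₁ (counts π) * count π (lab′ v′) ts c ∎
    where
    lab′ : Fin (suc n) → V
    lab′ j = lab (punchIn u j)
    kids′ : Fin (suc n) → Fin D → Tree
    kids′ j = kids (punchIn u j)
    K : Pinning V q → ℚ
    K π = ∑ (count π (lab u) (kids u))
    open ≡-Reasoning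
    ih = eliminate lab′ (λ eq → punchIn-injective u _ _ (inj eq)) v′
           (λ i i≢v′ → v-min (punchIn u i) (λ eq → i≢v′ (punchIn-injective u _ _ eq)))
           kids′ (λ i j → empty (punchIn u i) (punchIn u j)) (λ i → valid (punchIn u i))
    ts = proj₁ ih
    ts-valid = proj₁ (proj₂ ih)
    counts = proj₂ (proj₂ ih)
  ...     | yes (w , u~w) = ts , ts-valid , λ π → proj₁ (counts π) , λ c →
              trans (∑maps-insertAt (suc n) u (weightOf-ext lab kids π (punchIn u v′) c))
                (trans (∑maps-cong (suc n) λ τ → ∑weightOf-leaf lab kids π u v′ c τ u~w unique empty-w)
                  (proj₂ (counts π) c))
    where
    lab′ : Fin (suc n) → V
    lab′ j = lab (punchIn u j)
    inj′ : ∀ {i j} → lab′ i ≡ lab′ j → i ≡ j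
    inj′ eq = punchIn-injective u _ _ (inj eq)
    -- As u has the largest rank, no remaining neighbour exceeds it and `parent-unique` applies to
    -- any two of them.
    unique : ∀ j → lab u ~ lab′ j → j ≡ w
    unique j adj = inj′ (parent-unique adj u~w (u-max _) (u-max _))
    s₀ = slot (lab′ w) (lab u)
    empty-w : kids (punchIn u w) s₀ ≡ ∅
    empty-w = empty (punchIn u w) u (~-sym u~w)
    t = node (lab u) (kids u)
    kids′ : Fin (suc n) → Fin D → Tree
    kids′ j = if does (j ≟ᶠ w) then attach (kids (punchIn u j)) s₀ t else kids (punchIn u j)
    empty′ : EmptySlots lab′ kids′
    empty′ i j adj with i ≟ᶠ w
    ... | no _     = empty (punchIn u i) (punchIn u j) adj
    -- Slots are injective and u has been removed, so the slot of w towards any remaining neighbour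
    -- differs from s₀.
    ... | yes refl = trans
      (attach-other (kids (punchIn u w)) t λ eq → punchInᵢ≢i u j (inj (slot-injective adj (~-sym u~w) eq)))
      (empty (punchIn u w) (punchIn u j) adj)
    valid′ : ∀ i → Valid (node (lab′ i) (kids′ i))
    valid′ i s with i ≟ᶠ w
    ... | no _ = valid (punchIn u i) s
    ... | yes refl with s ≟ᶠ s₀
    ...   | yes _ = ~-sym u~w , valid u
    ...   | no _  = valid (punchIn u w) s
    ih = eliminate lab′ inj′ v′
           (λ i i≢v′ → v-min (punchIn u i) (λ eq → i≢v′ (punchIn-injective u _ _ eq)))
           kids′ empty′ valid′
    ts = proj₁ ih
    ts-valid = proj₁ (proj₂ ih)
    counts = proj₂ (proj₂ ih)

-- Orienting 𝕋 d towards a vertex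

module _ {d : ℕ} where

  height : TreeVertex d → ℕ
  height root       = 0
  height (node i p) = suc (length p)

  height-child : ∀ {u w : TreeVertex d} → Child u w → height w ≡ suc (height u)
  height-child top      = refl
  height-child (down k) = refl

  parent-unique : ∀ {u u′ w : TreeVertex d} → Child u w → Child u′ w → u ≡ u′
  parent-unique top      top      = refl
  parent-unique (down k) (down k) = refl

  ¬Child-sym : ∀ {u w : TreeVertex d} → Child u w → ¬ Child w u
  ¬Child-sym c c′ = ℕ.m≢1+n+m _ {1} (trans (height-child c′) (cong suc (height-child c)))

  -- Below the first level the turns are shifted by one, which frees slot zero for the parent; the
  -- root has no parent and gives all d + 1 slots to its children. The value at the root itself is a
  -- default.
  branch : TreeVertex d → Fin (suc d)
  branch root             = zero
  branch (node i [])      = i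
  branch (node i (k ∷ p)) = suc k

  slot : TreeVertex d → TreeVertex d → Fin (suc d)
  slot u w = if does (child? u w) then branch w else zero

  slot-child : ∀ {u w} → Child u w → slot u w ≡ branch w
  slot-child {u} {w} c = cong (if_then branch w else zero) (dec-true (child? u w) c)

  slot-parent : ∀ {u w} → Child w u → slot u w ≡ zero
  slot-parent {u} {w} c = cong (if_then branch w else zero) (dec-false (child? u w) (¬Child-sym c))

  branch≢zero : ∀ {u w w′} → Child u w → Child w′ u → branch w ≢ zero
  branch≢zero (down k) _ ()

  branch-injective : ∀ {u w w′} → Child u w → Child u w′ → branch w ≡ branch w′ → w ≡ w′
  branch-injective top      top      refl = refl
  branch-injective (down k) (down k) refl = refl

  slot-injective : ∀ {u w w′} → Graph._~_ (𝕋 d) u w → Graph._~_ (𝕋 d) u w′ → slot u w ≡ slot u w′ → w ≡ w′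
  slot-injective (inj₁ c) (inj₁ c′) eq = branch-injective c c′ (trans (sym (slot-child c)) (trans eq (slot-child c′)))
  slot-injective (inj₁ c) (inj₂ c′) eq =
    contradiction (trans (sym (slot-child c)) (trans eq (slot-parent c′))) (branch≢zero c c′)
  slot-injective (inj₂ c) (inj₁ c′) eq =
    contradiction (trans (sym (slot-child c′)) (trans (sym eq) (slot-parent c))) (branch≢zero c′ c)
  slot-injective (inj₂ c) (inj₂ c′) eq = parent-unique c c′

  data Ancestor (u : TreeVertex d) : TreeVertex d → Set where
    here  : Ancestor u u
    there : ∀ {w v} → Ancestor u w → Child w v → Ancestor u v

  _≟ᵀ_ : DecidableEquality (TreeVertex d)
  root     ≟ᵀ root     = yes refl
  root     ≟ᵀ node _ _ = no λ ()
  node _ _ ≟ᵀ root     = no λ ()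
  node i p ≟ᵀ node j r = map′ (λ { (refl , refl) → refl }) (λ { refl → refl , refl })
    ((i ≟ᶠ j) ×-dec List-≡-dec _≟ᶠ_ p r)

  extend : ∀ {u w v} → Child w v → u ≡ v ⊎ Ancestor u w → Ancestor u v
  extend c (inj₁ refl) = here
  extend c (inj₂ a)    = there a c

  shorten : ∀ {u w v} → Child w v → Ancestor u v → u ≡ v ⊎ Ancestor u w
  shorten c here         = inj₁ refl
  shorten c (there a c′) = inj₂ (subst (Ancestor _) (parent-unique c′ c) a)

  ancestor? : ∀ u v → Dec (Ancestor u v)
  ancestor? u root = map′ (λ { refl → here }) (λ { here → refl }) (u ≟ᵀ root)
  ancestor? u (node i []) = map′ (extend top) (shorten top) ((u ≟ᵀ node i []) ⊎-dec ancestor? u root)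
  ancestor? u (node i (k ∷ p)) = map′ (extend (down k)) (shorten (down k))
    ((u ≟ᵀ node i (k ∷ p)) ⊎-dec ancestor? u (node i p))

  root-ancestor : ∀ v → Ancestor root v
  root-ancestor root             = here
  root-ancestor (node i [])      = there here top
  root-ancestor (node i (k ∷ p)) = there (root-ancestor (node i p)) (down k)

  ancestor-height : ∀ {u v} → Ancestor u v → height u ℕ.≤ height v
  ancestor-height here        = ℕ.≤-refl
  ancestor-height (there a c) = ℕ.≤-trans (ancestor-height a) (ℕ.≤-trans (ℕ.n≤1+n _) (ℕ.≤-reflexive (sym (height-child c))))

  ancestor-height-< : ∀ {u w v} → Ancestor u w → Child w v → height u ℕ.< height v
  ancestor-height-< a c = ℕ.≤-trans (ℕ.s≤s (ancestor-height a)) (ℕ.≤-reflexive (sym (height-child c)))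

  parent-ancestor : ∀ {u w v} → Child w u → Ancestor u v → Ancestor w v
  parent-ancestor c here         = there here c
  parent-ancestor c (there a c′) = there (parent-ancestor c a) c′

  ancestor-unique : ∀ {u w v} → Ancestor u v → Ancestor w v → height u ≡ height w → u ≡ w
  ancestor-unique here         here         eq = refl
  ancestor-unique here         (there b c)  eq = contradiction (sym eq) (ℕ.<⇒≢ (ancestor-height-< b c))
  ancestor-unique (there a c)  here         eq = contradiction eq (ℕ.<⇒≢ (ancestor-height-< a c))
  ancestor-unique (there a c)  (there b c′) eq = ancestor-unique a (subst (Ancestor _) (parent-unique c′ c) b) eq

  -- Decreases along the first edge of the path from u to v.
  rank : TreeVertex d → TreeVertex d → ℕ
  rank v u = if does (ancestor? u v) then height v ℕ.∸ height u else height v ℕ.+ height u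

  rank-ancestor : ∀ {u v} → Ancestor u v → rank v u ≡ height v ℕ.∸ height u
  rank-ancestor {u} {v} a = cong (if_then height v ℕ.∸ height u else (height v ℕ.+ height u)) (dec-true (ancestor? u v) a)

  rank-nonancestor : ∀ {u v} → ¬ Ancestor u v → rank v u ≡ height v ℕ.+ height u
  rank-nonancestor {u} {v} ¬a = cong (if_then height v ℕ.∸ height u else (height v ℕ.+ height u)) (dec-false (ancestor? u v) ¬a)

  rank≤ : ∀ u v → rank v u ℕ.≤ height v ℕ.+ height u
  rank≤ u v with ancestor? u v
  ... | yes _ = ℕ.≤-trans (ℕ.m∸n≤m (height v) (height u)) (ℕ.m≤m+n (height v) (height u))
  ... | no _  = ℕ.≤-refl

  rank-minimum : ∀ {u v} → u ≢ v → rank v v ℕ.< rank v u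
  rank-minimum {u} {v} u≢v = subst (ℕ._< rank v u) (sym (trans (rank-ancestor {v} {v} here) (ℕ.n∸n≡0 (height v)))) (0<rank (ancestor? u v))
    where
    0<rank : Dec (Ancestor u v) → 0 ℕ.< rank v u
    0<rank (yes here)        = contradiction refl u≢v
    0<rank (yes (there a c)) = subst (0 ℕ.<_) (sym (rank-ancestor (there a c))) (ℕ.m<n⇒0<n∸m (ancestor-height-< a c))
    0<rank (no ¬a)           = subst (0 ℕ.<_) (sym (rank-nonancestor ¬a)) (ℕ.≤-trans (height-0<rank u ¬a) (ℕ.m≤n+m (height u) (height v)))
      where
      height-0<rank : ∀ u → ¬ Ancestor u v → 0 ℕ.< height u
      height-0<rank root       ¬a = contradiction (root-ancestor v) ¬a
      height-0<rank (node i p) ¬a = ℕ.s≤s ℕ.z≤n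

  -- Stepping from an ancestor of v to its parent leads away from v and raises the rank.
  rank-parent : ∀ {u w v} → Child w u → rank v w ℕ.≤ rank v u → ¬ Ancestor u v
  rank-parent {u} {w} {v} c w≤u a = ℕ.<⇒≱
    (ℕ.∸-monoʳ-< (ℕ.≤-reflexive (sym (height-child c))) (ancestor-height a))
    (subst₂ ℕ._≤_ (rank-ancestor (parent-ancestor c a)) (rank-ancestor a) w≤u)

  -- A child that is not an ancestor of v has rank `height v + height w`, one more than the largest
  -- rank possible for its parent.
  rank-child : ∀ {u w v} → Child u w → rank v w ℕ.≤ rank v u → Ancestor w v
  rank-child {u} {w} {v} c w≤u with ancestor? w v
  ... | yes a = a
  ... | no ¬a = contradiction
    (ℕ.≤-trans w≤u (rank≤ u v))
    (ℕ.<⇒≱ (ℕ.+-monoʳ-< (height v) (ℕ.≤-reflexive (sym (height-child c)))))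

  -- A neighbour of no larger rank is the next vertex towards v: the parent of u if u is not an
  -- ancestor of v, and otherwise the child on the path down to v.
  rank-parent-unique : ∀ {v u w w′} → Graph._~_ (𝕋 d) u w → Graph._~_ (𝕋 d) u w′ →
                       rank v w ℕ.≤ rank v u → rank v w′ ℕ.≤ rank v u → w ≡ w′
  rank-parent-unique (inj₂ c) (inj₂ c′) _ _ = parent-unique c c′
  rank-parent-unique {v} (inj₂ c) (inj₁ c′) r r′ =
    contradiction (parent-ancestor c′ (rank-child {v = v} c′ r′)) (rank-parent {v = v} c r)
  rank-parent-unique {v} (inj₁ c) (inj₂ c′) r r′ =
    contradiction (parent-ancestor c (rank-child {v = v} c r)) (rank-parent {v = v} c′ r′)
  rank-parent-unique {v} (inj₁ c) (inj₁ c′) r r′ =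
    ancestor-unique (rank-child {v = v} c r) (rank-child {v = v} c′ r′) (trans (height-child c) (sym (height-child c′)))

-- Counting colourings

∑-++ : ∀ k {l} (g : Fin (k ℕ.+ l) → ℚ) → ∑ g ≡ ∑ (λ i → g (i ↑ˡ l)) + ∑ (λ j → g (k ↑ʳ j))
∑-++ zero    g = sym (+-identityˡ (∑ g))
∑-++ (suc k) g = trans (cong (λ z → g zero + z) (∑-++ k (λ i → g (suc i)))) (sym (+-assoc (g zero) _ _))

∑-combine : ∀ m {k} (g : Fin (m ℕ.* k) → ℚ) → ∑ g ≡ ∑ λ a → ∑ λ b → g (combine {m} a b)
∑-combine zero        g = refl
∑-combine (suc m) {k} g = trans (∑-++ k g) (cong (λ z → ∑ (λ b → g (b ↑ˡ (m ℕ.* k))) + z) (∑-combine m (λ j → g (k ↑ʳ j))))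

∑-finToFun : ∀ {q} n {g : (Fin n → Fin q) → ℚ} → Extensional g → ∑ {q ℕ.^ n} (λ i → g (finToFun i)) ≡ ∑maps n g
∑-finToFun zero    {g} ext = trans (+-identityʳ _) (ext _ _ λ ())
∑-finToFun {q} (suc n) {g} ext = trans (∑-combine q {q ℕ.^ n} (λ i → g (finToFun i)))
  (∑-cong λ a → trans
    (∑-cong λ b → ext (finToFun (combine a b)) (a ∷ᶠ finToFun b) λ
      { zero    → cong proj₁ (remQuot-combine {q} {q ℕ.^ n} a b)
      ; (suc j) → cong (λ z → finToFun (proj₂ z) j) (remQuot-combine {q} {q ℕ.^ n} a b) })
    (∑-finToFun n {λ τ → g (a ∷ᶠ τ)} λ τ τ′ eq → ext (a ∷ᶠ τ) (a ∷ᶠ τ′) (∷ᶠ-cong a eq)))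

length-filter-tabulate : ∀ {A : Set} {P : Pred A _} (P? : Decidable P) {n} (f : Fin n → A) →
                         fromℕ (length (filter P? (tabulate f))) ≡ ∑ λ i → indicator (P? (f i))
length-filter-tabulate P? {zero}  f = refl
length-filter-tabulate P? {suc n} f with does (P? (f zero))
... | false = trans (length-filter-tabulate P? (λ i → f (suc i))) (sym (+-identityˡ _))
... | true  = trans (fromℕ-suc (length (filter P? (tabulate (λ i → f (suc i))))))
                (cong (λ z → 1ℚ + z) (length-filter-tabulate P? (λ i → f (suc i))))

/-fromℕ : ∀ a n .{{_ : ℕ.NonZero n}} → + a / n ≡ fromℕ a * (+ 1 / n)
/-fromℕ a n@(suc n-1) = toℚᵘ-injective (begin
  toℚᵘ (+ a / n)                      ≈⟨ toℚᵘ-fromℚᵘ (mkℚᵘ (+ a) n-1) ⟩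
  mkℚᵘ (+ a) n-1                      ≈⟨ *≡* (cong₂ ℤ._*_ (sym (ℤ.*-identityʳ (+ a))) (ℤ.*-identityˡ (+ n))) ⟩
  mkℚᵘ (+ a) 0 ℚᵘ.* mkℚᵘ (+ 1) n-1    ≈⟨ ℚᵘ.*-cong (ℚᵘ.≃-sym (toℚᵘ-fromℚᵘ (mkℚᵘ (+ a) 0))) (ℚᵘ.≃-sym (toℚᵘ-fromℚᵘ (mkℚᵘ (+ 1) n-1))) ⟩
  toℚᵘ (fromℕ a) ℚᵘ.* toℚᵘ (+ 1 / n)  ≈⟨ ℚᵘ.≃-sym (toℚᵘ-homo-* (fromℕ a) (+ 1 / n)) ⟩
  toℚᵘ (fromℕ a * (+ 1 / n))          ∎)
  where open ℚᵘ.≃-Reasoning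

-- The common denominator n, the number of proper colourings in the application, cancels.
/÷/ : ∀ a b n .{{_ : ℕ.NonZero n}} .{{_ : ℚ.NonZero (+ b / n)}} {x} →
      fromℕ a ≡ x * fromℕ b → (+ a / n) ÷ (+ b / n) ≡ x
/÷/ a b n {x} eq = begin
  + a / n * (1/ (+ b / n))                       ≡⟨ cong (_* (1/ (+ b / n))) (/-fromℕ a n) ⟩
  fromℕ a * (+ 1 / n) * (1/ (+ b / n))           ≡⟨ cong (λ z → z * (+ 1 / n) * (1/ (+ b / n))) eq ⟩
  x * fromℕ b * (+ 1 / n) * (1/ (+ b / n))       ≡⟨ cong (_* (1/ (+ b / n))) (*-assoc x (fromℕ b) (+ 1 / n)) ⟩
  x * (fromℕ b * (+ 1 / n)) * (1/ (+ b / n))     ≡⟨ cong (λ z → x * z * (1/ (+ b / n))) (/-fromℕ b n) ⟨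
  x * (+ b / n) * (1/ (+ b / n))                 ≡⟨ *-assoc x (+ b / n) (1/ (+ b / n)) ⟩
  x * (+ b / n * (1/ (+ b / n)))                 ≡⟨ cong (x *_) (*-inverseʳ (+ b / n)) ⟩
  x * 1ℚ                                         ≡⟨ *-identityʳ x ⟩
  x                                              ∎
  where open ≡-Reasoning

-- Marginals as messages at the root

pinAt : ∀ {n q} {Λ : Subset n} → (∀ v → .(v ∈ Λ) → Fin q) → ∀ v → Dec (v ∈ Λ) → Maybe (Fin q)
pinAt η v (yes v∈Λ) = just (η v v∈Λ)
pinAt η v (no _)    = nothing

pinning : ∀ {n q} {Λ : Subset n} → (∀ v → .(v ∈ Λ) → Fin q) → Pinning (Fin n) q
pinning {Λ = Λ} η v = pinAt η v (v ∈? Λ)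

module _ {n q : ℕ} (G : Graph (Fin n)) where
  open Graph G
  open Colouring G q

  extends-allows : ∀ {Λ : Subset n} (η : Assignment Λ) σ →
                   indicator (extends? η σ) ≡ ∏ λ i → allows (pinning η i) (σ i)
  extends-allows {Λ} η σ = sym (trans (∏-cong λ v → sym (proj₂ (at v (v ∈? Λ))))
    (∏-indicator (λ v → proj₁ (at v (v ∈? Λ))) (extends? η σ)))
    where
    -- Deciding the condition at v along its membership in Λ makes the indicator compute to
    -- `allows`.
    at : ∀ v (v∈?Λ : Dec (v ∈ Λ)) → ∃[ P? ] indicator {∀ (v∈Λ : v ∈ Λ) → σ v ≡ η v v∈Λ} P? ≡ allows (pinAt η v v∈?Λ) (σ v)
    at v (yes v∈Λ) = map′ (λ eq _ → sym eq) (λ f → sym (f v∈Λ)) (η v v∈Λ ≟ᶠ σ v) , refl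
    at v (no v∉Λ)  = yes (λ v∈Λ → contradiction v∈Λ v∉Λ) , refl

  Proper-resp : ∀ {σ τ} → σ ≗ τ → Proper σ → Proper τ
  Proper-resp eq pr u v adj = subst₂ _≢_ (eq u) (eq v) (pr u v adj)

  #Proper-∑maps : ∀ {A : Pred Map _} (A? : Decidable A) → (∀ {σ τ} → σ ≗ τ → A σ → A τ) →
                  fromℕ (#Proper A?) ≡ ∑maps n λ σ → indicator (proper? σ) * indicator (A? σ)
  #Proper-∑maps A? resp = trans (length-filter-tabulate (λ σ → proper? σ ×-dec A? σ) {q ℕ.^ n} finToFun)
    (trans (∑-finToFun n {λ σ → indicator (proper? σ ×-dec A? σ)} λ σ τ eq →
        indicator-⇔ (mk⇔ (λ (pr , a) → Proper-resp eq pr , resp eq a)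
                         (λ (pr , a) → Proper-resp (sym ∘ eq) pr , resp (sym ∘ eq) a))
          (proper? σ ×-dec A? σ) (proper? τ ×-dec A? τ))
      (∑maps-cong n λ σ → indicator-× (proper? σ) (A? σ)))

  Extends-resp : ∀ {Λ : Subset n} (η : Assignment Λ) {σ τ} → σ ≗ τ → Extends η σ → Extends η τ
  Extends-resp η eq ex v v∈Λ = trans (sym (eq v)) (ex v v∈Λ)

module _ {n : ℕ} (G : Graph (Fin n)) where
  open Graph G

  snoc : ∀ {u v w k} → Walk u v k → v ~ w → Walk u w (suc k)
  snoc []      e = e ∷ []
  snoc (f ∷ p) e = f ∷ snoc p e

module Marginals {d q n : ℕ}
  (101≤gap : + 101 / 1 ≤ fromℕ q - fromℕ (suc d))
  (D≤gap : fromℕ (suc d) ≤ + 100 / 59 * (fromℕ q - fromℕ (suc d)))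
  (G : Graph (Fin (suc n)))
  (embed : Fin (suc n) → TreeVertex d)
  (injective : Injective _≡_ _≡_ embed)
  (subgraph : Graph._~_ G =[ embed ]⇒ Graph._~_ (𝕋 d))
  (v : Fin (suc n))
  where

  open Graph G

  private
    D : ℕ
    D = suc d

  open Colouring G q
  open TreeMessages d q 101≤gap D≤gap {Fin (suc n)}
  open Contraction d q 101≤gap D≤gap
  open Elimination G {D} {q}
    (λ u w → slot (embed u) (embed w))
    (λ e e′ eq → injective (slot-injective (subgraph e) (subgraph e′) eq))
    (λ u → rank (embed v) (embed u))
    (λ e e′ r r′ → injective (rank-parent-unique {v = embed v} (subgraph e) (subgraph e′) r r′))

  private
    bare : Fin (suc n) → Fin D → Tree
    bare _ _ = ∅

    eliminated = eliminate id id v (λ i i≢v → rank-minimum (i≢v ∘ injective))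
      bare (λ _ _ _ → refl) (λ _ _ → tt , tt)

  children : Fin D → Tree
  children = proj₁ eliminated

  valid : Valid (node v children)
  valid = proj₁ (proj₂ eliminated)

  module _ {Λ : Subset (suc n)} (η : Assignment Λ) where

    private
      π = pinning η
      W : Fin q → (Fin (suc n) → Fin q) → ℚ
      W = weightOf id bare π v
      p = message π (node v children)
      κ₁ = proj₁ (proj₂ (proj₂ eliminated) π)
      κ₂ = proj₁ (count-scale π v children)

      indicators : ∀ c σ → W c σ ≡ δ c (σ v) * (indicator (proper? σ) * indicator (extends? η σ))
      indicators c σ = trans
        (cong (δ c (σ v) * indicator (proper? σ) *_)
          (trans (∏-cong {g = λ i → allows (π i) (σ i)} λ i → trans (cong (allows (π i) (σ i) *_) (∏-1 D)) (*-identityʳ (allows (π i) (σ i))))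
            (sym (extends-allows G η σ))))
        (*-assoc (δ c (σ v)) (indicator (proper? σ)) (indicator (extends? η σ)))

      ∑W : ∀ c → ∑maps (suc n) (W c) ≡ κ₁ * κ₂ * p c
      ∑W c = trans (proj₂ (proj₂ (proj₂ eliminated) π) c)
        (trans (cong (κ₁ *_) (proj₂ (count-scale π v children) c)) (sym (*-assoc κ₁ κ₂ (p c))))

    -- The message at the root has mass 1, so the constant of proportionality is itself the number
    -- of extensions.
    #extends : fromℕ (#Proper (extends? η)) ≡ κ₁ * κ₂
    #extends = begin
      fromℕ (#Proper (extends? η))
        ≡⟨ #Proper-∑maps G (extends? η) (Extends-resp G η) ⟩
      ∑maps (suc n) (λ σ → indicator (proper? σ) * indicator (extends? η σ))
        ≡⟨ ∑maps-cong (suc n) split ⟩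
      ∑maps (suc n) (λ σ → ∑ λ c → W c σ)
        ≡⟨ ∑maps-∑ (suc n) W ⟨
      ∑ (λ c → ∑maps (suc n) (W c))
        ≡⟨ ∑-cong ∑W ⟩
      ∑ (λ c → κ₁ * κ₂ * p c)
        ≡⟨ ∑-*ˡ (κ₁ * κ₂) p ⟩
      κ₁ * κ₂ * ∑ p
        ≡⟨ cong (κ₁ * κ₂ *_) (∑message≡1 π v children) ⟩
      κ₁ * κ₂ * 1ℚ
        ≡⟨ *-identityʳ (κ₁ * κ₂) ⟩
      κ₁ * κ₂ ∎
      where
      open ≡-Reasoning
      X : Map → ℚ
      X σ = indicator (proper? σ) * indicator (extends? η σ)
      split : ∀ σ → X σ ≡ ∑ λ c → W c σ
      split σ = begin
        X σ                            ≡⟨ *-identityˡ (X σ) ⟨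
        1ℚ * X σ                       ≡⟨ cong (_* X σ) (∑δ≡1 (σ v)) ⟨
        ∑ (δ (σ v)) * X σ              ≡⟨ ∑-*ʳ (X σ) (δ (σ v)) ⟨
        ∑ (λ c → δ (σ v) c * X σ)      ≡⟨ ∑-cong (λ c → trans (cong (_* X σ) (δ-sym (σ v) c)) (sym (indicators c σ))) ⟩
        ∑ (λ c → W c σ)                ∎

    #extends-coloured : ∀ c → fromℕ (#Proper (λ σ → hasColour? v c σ ×-dec extends? η σ)) ≡ κ₁ * κ₂ * p c
    #extends-coloured c = begin
      fromℕ (#Proper (λ σ → hasColour? v c σ ×-dec extends? η σ))
        ≡⟨ #Proper-∑maps G (λ σ → hasColour? v c σ ×-dec extends? η σ)
             (λ eq (hc , ex) → trans (sym (eq v)) hc , Extends-resp G η eq ex) ⟩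
      ∑maps (suc n) (λ σ → indicator (proper? σ) * indicator (hasColour? v c σ ×-dec extends? η σ))
        ≡⟨ ∑maps-cong (suc n) (λ σ → trans
             (cong (indicator (proper? σ) *_) (trans (indicator-× (hasColour? v c σ) (extends? η σ))
               (cong (_* indicator (extends? η σ)) (δ-sym (σ v) c))))
             (trans (lemma (indicator (proper? σ)) (δ c (σ v)) (indicator (extends? η σ))) (sym (indicators c σ)))) ⟩
      ∑maps (suc n) (W c)
        ≡⟨ ∑W c ⟩
      κ₁ * κ₂ * p c ∎
      where
      open ≡-Reasoning
      lemma : ∀ a b c → a * (b * c) ≡ b * (a * c)
      lemma = solve-∀ ℚ-ring

    marginal≡message : ∀ ext c → marginal η ext v c ≡ message (pinning η) (node v children) c
    marginal≡message ext c = /÷/ (#Proper (λ σ → hasColour? v c σ ×-dec extends? η σ)) (#Proper (extends? η)) #Ω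
      {{#Ω-nonZero η ext}} {{μ-nonZero η ext {{#Ω-nonZero η ext}}}}
      (trans (#extends-coloured c) (trans (*-comm (κ₁ * κ₂) (p c)) (cong (p c *_) (sym #extends))))

  module _ {Λ : Subset (suc n)} (η η′ : Assignment Λ) {ℓ : ℕ}
           (far : ∀ u k → Disagree η η′ u → Walk v u k → ℓ ℕ.≤ k) where

    pinning-agrees : ∀ {u k} → Walk v u k → k ℕ.< ℓ → pinning η u ≡ pinning η′ u
    pinning-agrees {u} {k} walk k<ℓ with u ∈? Λ
    ... | no _ = refl
    ... | yes u∈Λ with η u u∈Λ ≟ᶠ η′ u u∈Λ
    ...   | yes eq = cong just eq
    ...   | no neq = contradiction (far u k (u∈Λ , neq) walk) (ℕ.<⇒≱ k<ℓ)

    -- A vertex at depth k is joined to v by a walk of length k, so all pins at depths below ℓ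
    -- agree; k + m is the greatest depth inspected.
    agree : ∀ m {u ts k} → Valid (node u ts) → Walk v u k → k ℕ.+ m ℕ.< ℓ →
            AgreeTo (pinning η) (pinning η′) m (node u ts)
    agree-child : ∀ m {u t k} → RootAdjacent u t → Valid t → Walk v u k → suc k ℕ.+ m ℕ.< ℓ →
                  AgreeTo (pinning η) (pinning η′) m t
    agree zero {k = k} val walk k<ℓ = pinning-agrees walk (subst (ℕ._< ℓ) (ℕ.+-identityʳ k) k<ℓ)
    agree (suc m) {k = k} val walk k<ℓ =
      pinning-agrees walk (ℕ.≤-<-trans (ℕ.m≤m+n k (suc m)) k<ℓ) ,
      λ s → agree-child m (proj₁ (val s)) (proj₂ (val s)) walk (subst (ℕ._< ℓ) (ℕ.+-suc k m) k<ℓ)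
    agree-child m {t = ∅}         _   _   _    _   = tt
    agree-child m {t = node w ts} adj val walk k<ℓ = agree m val (snoc G walk adj) k<ℓ

  marginal-difference : ∀ {Λ : Subset (suc n)} (η η′ : Assignment Λ) ext ext′ c m →
    HasDistance v (Disagree η η′) (suc (suc m)) →
    ∣ marginal η ext v c - marginal η′ ext′ v c ∣ ≤ + 2 / 1 * fromℕ D * σ ^ m
  marginal-difference η η′ ext ext′ c m (_ , far) = subst₂ (λ a b → ∣ a - b ∣ ≤ + 2 / 1 * fromℕ D * σ ^ m)
    (sym (marginal≡message η ext c)) (sym (marginal≡message η′ ext′ c))
    -- At distance m + 2 the pins agree at the depths 0 to m + 1, as `Chain-message` requires.
    (Chain⇒∣p-p′∣≤ (Chain-message (pinning η) (pinning η′) m (node v children)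
      (agree η η′ far (suc m) valid [] ℕ.≤-refl)) c)

  marginal-difference≤1 : ∀ {Λ : Subset (suc n)} (η η′ : Assignment Λ) ext ext′ c →
    ∣ marginal η ext v c - marginal η′ ext′ v c ∣ ≤ 1ℚ
  marginal-difference≤1 η η′ ext ext′ c = subst₂ (λ a b → ∣ a - b ∣ ≤ 1ℚ)
    (sym (marginal≡message η ext c)) (sym (marginal≡message η′ ext′ c))
    (bound (isM η) (isM η′))
    where
    isM : ∀ {Λ} (η : Assignment Λ) → IsMessage (message (pinning η) (node v children))
    isM η = message-isMessage (pinning η) (node v children)
    lemma : ∀ a b → 1ℚ - (a - b) ≡ (1ℚ - a) + b
    lemma = solve-∀ ℚ-ring
    lemma′ : ∀ a b → a - b - - 1ℚ ≡ (1ℚ - b) + a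
    lemma′ = solve-∀ ℚ-ring
    bound : ∀ {p p′} → IsMessage p → IsMessage p′ → ∣ p c - p′ c ∣ ≤ 1ℚ
    bound {p} {p′} m m′ = ∣p∣≤
      (≤-by _ (+-nonneg (0≤-diff (≤1 m c)) (nonneg m′ c)) (lemma (p c) (p′ c)))
      (≤-by _ (+-nonneg (0≤-diff (≤1 m′ c)) (nonneg m c)) (lemma′ (p c) (p′ c)))

-- Powers and the exponential function

^-nonneg : ∀ {p} → 0ℚ ≤ p → ∀ n → 0ℚ ≤ p ^ n
^-nonneg 0≤p zero    = from-yes (0ℚ ≤? 1ℚ)
^-nonneg 0≤p (suc n) = *-nonneg 0≤p (^-nonneg 0≤p n)

^-mono-≤ : ∀ {p q} → 0ℚ ≤ p → p ≤ q → ∀ n → p ^ n ≤ q ^ n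
^-mono-≤ 0≤p p≤q zero    = ≤-refl
^-mono-≤ 0≤p p≤q (suc n) = *-mono-≤ (≤-trans 0≤p p≤q) (^-nonneg 0≤p n) p≤q (^-mono-≤ 0≤p p≤q n)

^-antimono-≤ : ∀ {p m n} → 0ℚ ≤ p → p ≤ 1ℚ → m ℕ.≤ n → p ^ n ≤ p ^ m
^-antimono-≤ {n = zero} 0≤p p≤1 ℕ.z≤n = ≤-refl
^-antimono-≤ {p} {n = suc n} 0≤p p≤1 ℕ.z≤n =
  *-mono-≤ (from-yes (0ℚ ≤? 1ℚ)) (^-nonneg 0≤p n) p≤1 (^-antimono-≤ {m = 0} {n} 0≤p p≤1 ℕ.z≤n)
^-antimono-≤ 0≤p p≤1 (ℕ.s≤s m≤n) = *-monoˡ-≤ 0≤p (^-antimono-≤ 0≤p p≤1 m≤n)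

bernoulli : ∀ {x} → 0ℚ ≤ x → x ≤ 1ℚ → ∀ n → 1ℚ - fromℕ n * x ≤ (1ℚ - x) ^ n
bernoulli {x} 0≤x x≤1 zero = ≤-reflexive (lemma x)
  where
  lemma : ∀ x → 1ℚ - 0ℚ * x ≡ 1ℚ
  lemma = solve-∀ ℚ-ring
bernoulli {x} 0≤x x≤1 (suc n) = ≤-trans
  (≤-by (fromℕ n * (x * x)) (*-nonneg (fromℕ-nonneg n) (0≤p*p x))
    (trans (cong (λ z → (1ℚ - x) * (1ℚ - fromℕ n * x) - (1ℚ - z * x)) (fromℕ-suc n)) (lemma x (fromℕ n))))
  (*-monoˡ-≤ (0≤-diff x≤1) (bernoulli 0≤x x≤1 n))
  where
  lemma : ∀ x n → (1ℚ - x) * (1ℚ - n * x) - (1ℚ - (1ℚ + n) * x) ≡ n * (x * x)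
  lemma = solve-∀ ℚ-ring

^-*-assoc : ∀ p m n → (p ^ m) ^ n ≡ p ^ (m ℕ.* n)
^-*-assoc = SemiringExp.^-assocʳ (CommutativeRing.semiring +-*-commutativeRing)

-- Half of 1 - σ = 1/20: rounding up the block lengths in the comparison with the exponential may
-- double them.
α : ℚ
α = + 1 / 40

-- Splitting the exponent n into ℓ blocks of m ≤ 2n/ℓ factors, Bernoulli's
-- inequality bounds each block below by 1 - 2α = σ.
σ^ℓ≤expApprox : ∀ ℓ k → ℓ ℕ.≤ k → σ ^ ℓ ≤ expApprox (- (α * fromℕ ℓ)) k
σ^ℓ≤expApprox zero k _ = subst (λ z → 1ℚ ≤ z ^ suc k) (sym (lemma (+ 1 / suc k))) (one^ (suc k))
  where
  lemma : ∀ i → 1ℚ + - (+ 1 / 40 * 0ℚ) * i ≡ 1ℚ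
  lemma = solve-∀ ℚ-ring
  one^ : ∀ n → 1ℚ ≤ 1ℚ ^ n
  one^ zero    = ≤-refl
  one^ (suc n) = ≤-trans (one^ n) (≤-reflexive (sym (*-identityˡ (1ℚ ^ n))))
σ^ℓ≤expApprox ℓ@(suc _) k ℓ≤k = begin
  σ ^ ℓ                        ≤⟨ ^-mono-≤ (from-yes (0ℚ ≤? σ)) (≤-trans σ≤ (bernoulli 0≤x x≤1 m)) ℓ ⟩
  ((1ℚ - x) ^ m) ^ ℓ           ≡⟨ ^-*-assoc (1ℚ - x) m ℓ ⟩
  (1ℚ - x) ^ (m ℕ.* ℓ)         ≤⟨ ^-antimono-≤ (0≤-diff x≤1) (≤-by x 0≤x (lemma x)) n≤mℓ ⟩
  (1ℚ - x) ^ n                 ≡⟨ cong (λ z → (1ℚ + z) ^ n) (neg-distribˡ-* (α * fromℕ ℓ) i) ⟩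
  expApprox (- (α * fromℕ ℓ)) k ∎
  where
  open ≤-Reasoning
  n = suc k
  i = + 1 / n
  x = α * fromℕ ℓ * i
  m = suc (n ℕ./ ℓ)
  lemma : ∀ x → 1ℚ - (1ℚ - x) ≡ x
  lemma = solve-∀ ℚ-ring
  n≤mℓ : n ℕ.≤ m ℕ.* ℓ
  n≤mℓ = ℕ.≤-trans (ℕ.≤-reflexive (ℕ.m≡m%n+[m/n]*n n ℓ)) (ℕ.+-monoˡ-≤ _ (ℕ.<⇒≤ (ℕ.m%n<n n ℓ)))
  mℓ≤2n : m ℕ.* ℓ ℕ.≤ n ℕ.+ n
  mℓ≤2n = ℕ.+-mono-≤ (ℕ.≤-trans ℓ≤k (ℕ.n≤1+n k)) (ℕ.m/n*n≤m n ℓ)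
  ni : fromℕ n * i ≡ 1ℚ
  ni = trans (sym (/-fromℕ n n)) (toℚᵘ-injective (toℚᵘ-n/n))
    where
    toℚᵘ-n/n : toℚᵘ (+ n / n) ℚᵘ.≃ toℚᵘ 1ℚ
    toℚᵘ-n/n = ℚᵘ.≃-trans (toℚᵘ-fromℚᵘ (mkℚᵘ (+ n) k)) (*≡* (ℤ.*-comm (+ n) (+ 1)))
  0≤i : 0ℚ ≤ i
  0≤i = nonNegative⁻¹ i {{normalize-nonNeg 1 n}}
  0≤x : 0ℚ ≤ x
  0≤x = *-nonneg (*-nonneg (from-yes (0ℚ ≤? α)) (fromℕ-nonneg ℓ)) 0≤i
  ℓi≤1 : fromℕ ℓ * i ≤ 1ℚ
  ℓi≤1 = subst (fromℕ ℓ * i ≤_) ni (*-monoʳ-≤ 0≤i (fromℕ-mono-≤ (ℕ.≤-trans ℓ≤k (ℕ.n≤1+n k))))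
  x≤1 : x ≤ 1ℚ
  x≤1 = subst (_≤ 1ℚ) (sym (*-assoc α (fromℕ ℓ) i)) (≤-trans (*-monoˡ-≤ (from-yes (0ℚ ≤? α)) ℓi≤1) (from-yes (α * 1ℚ ≤? 1ℚ)))
  mℓi≤2 : fromℕ (m ℕ.* ℓ) * i ≤ + 2 / 1
  mℓi≤2 = ≤-trans (*-monoʳ-≤ 0≤i (fromℕ-mono-≤ mℓ≤2n))
    (≤-reflexive (trans (cong (_* i) (fromℕ-+ n n)) (trans (*-distribʳ-+ i (fromℕ n) (fromℕ n)) (cong₂ _+_ ni ni))))
  σ≤ : σ ≤ 1ℚ - fromℕ m * x
  σ≤ = ≤-by _ (*-nonneg (from-yes (0ℚ ≤? α)) (0≤-diff mℓi≤2))
    (trans (eq (fromℕ m) (fromℕ ℓ) i) (cong (λ z → α * (+ 2 / 1 - z * i)) (sym (fromℕ-* m ℓ))))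
    where
    eq : ∀ m ℓ i → 1ℚ - m * (+ 1 / 40 * ℓ * i) - + 19 / 20 ≡ + 1 / 40 * (+ 2 / 1 - m * ℓ * i)
    eq = solve-∀ ℚ-ring

module Decay (d : ℕ) where

  -- 800/361 = 2 σ⁻², so that C σ^ℓ is the chain bound 2 D σ^(ℓ - 2).
  C : ℚ
  C = + 800 / 361 * fromℕ (suc d)

  ζ : ℕ → ℚ
  ζ ℓ = 1ℚ ⊓ (C * σ ^ ℓ)

  C-pos : 0ℚ < C
  C-pos = *-pos (from-yes (0ℚ <? + 800 / 361)) (fromℕ-pos (suc d))

  0≤Cσ^ℓ : ∀ ℓ → 0ℚ ≤ C * σ ^ ℓ
  0≤Cσ^ℓ ℓ = *-nonneg (<⇒≤ C-pos) (^-nonneg (from-yes (0ℚ ≤? σ)) ℓ)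

  ζ-nonneg : ∀ ℓ → 0ℚ ≤ ζ ℓ
  ζ-nonneg ℓ = ⊓-glb (from-yes (0ℚ ≤? 1ℚ)) (0≤Cσ^ℓ ℓ)

  ζ-exp : ∀ ℓ → ζ ℓ ≤ C ·exp (- (α * fromℕ ℓ))
  -- From index ℓ on the approximations already dominate σ^ℓ, so the same threshold serves every ε.
  ζ-exp ℓ ε 0<ε = ℓ , λ k ℓ≤k → ≤-trans (p⊓q≤q 1ℚ (C * σ ^ ℓ))
    (≤-trans (*-monoˡ-≤ (<⇒≤ C-pos) (σ^ℓ≤expApprox ℓ k ℓ≤k))
      (≤-by ε (<⇒≤ 0<ε) (lemma (C * expApprox (- (α * fromℕ ℓ)) k) ε)))
    where
    lemma : ∀ a e → a + e - a ≡ e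
    lemma = solve-∀ ℚ-ring

  1≤Cσ : 1ℚ ≤ C * (σ * 1ℚ)
  1≤Cσ = ≤-trans (from-yes (1ℚ ≤? + 800 / 361 * 1ℚ * (σ * 1ℚ)))
    (*-monoʳ-≤ (from-yes (0ℚ ≤? σ * 1ℚ)) (*-monoˡ-≤ (from-yes (0ℚ ≤? + 800 / 361)) (fromℕ-mono-≤ {1} {suc d} (ℕ.s≤s ℕ.z≤n))))

  -- Distances 0 and 1 leave no room for a chain; there the trivial bound 1 is enough, since C σ ≥
  -- 40/19.
  ≤ζ : ∀ {x} ℓ → x ≤ 1ℚ → (∀ m → ℓ ≡ suc (suc m) → x ≤ + 2 / 1 * fromℕ (suc d) * σ ^ m) → x ≤ ζ ℓ
  ≤ζ 0 x≤1 _ = ⊓-glb x≤1 (≤-trans x≤1 (≤-trans 1≤Cσ (*-monoˡ-≤ (<⇒≤ C-pos) (from-yes (σ * 1ℚ ≤? 1ℚ)))))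
  ≤ζ 1 x≤1 _ = ⊓-glb x≤1 (≤-trans x≤1 1≤Cσ)
  ≤ζ (suc (suc m)) x≤1 x≤ = ⊓-glb x≤1 (≤-trans (x≤ m refl) (≤-reflexive (lemma (fromℕ (suc d)) (σ ^ m))))
    where
    lemma : ∀ D s → + 2 / 1 * D * s ≡ + 800 / 361 * D * (+ 19 / 20 * (+ 19 / 20 * s))
    lemma = solve-∀ ℚ-ring

-- Constants and conclusion

mixing : ∀ {d q n} → + 101 / 1 ≤ fromℕ q - fromℕ (suc d) →
  fromℕ (suc d) ≤ + 100 / 59 * (fromℕ q - fromℕ (suc d)) →
  (G : Graph (Fin n)) (embed : Fin n → TreeVertex d) → Injective _≡_ _≡_ embed →
  Graph._~_ G =[ embed ]⇒ Graph._~_ (𝕋 d) → StrongSpatialMixing G q (Decay.ζ d)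
mixing {n = zero} _ _ _ _ _ _ ()
mixing {d} {q} {suc n} 101≤gap D≤gap G embed injective subgraph v Λ η η′ ext ext′ c ℓ dist =
  Decay.≤ζ d ℓ (marginal-difference≤1 η η′ ext ext′ c)
    (λ { m refl → marginal-difference η η′ ext ext′ c m dist })
  where open Marginals {d} {q} {n} 101≤gap D≤gap G embed injective subgraph v

-- Gives q - (d + 1) ≥ 0.59 d + 102, which covers the gap 101 behind the message bound 1/101. The
-- constant part also pays for the 1 in D = d + 1, as 100/59 · 102 - 1 = 10141/59.
β : ℚ
β = + 103 / 1

module _ {q d : ℕ} (q≥ : fromℕ q ≥ + 159 / 100 * fromℕ d + β) where

  gap-large : + 101 / 1 ≤ fromℕ q - fromℕ (suc d)
  gap-large = ≤-by _ (+-nonneg (0≤-diff q≥)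
      (+-nonneg (*-nonneg (from-yes (0ℚ ≤? + 59 / 100)) (fromℕ-nonneg d)) (from-yes (0ℚ ≤? 1ℚ))))
    (trans (cong (λ z → fromℕ q - z - + 101 / 1) (fromℕ-suc d)) (lemma (fromℕ q) (fromℕ d)))
    where
    lemma : ∀ q d → q - (1ℚ + d) - + 101 / 1 ≡ (q - (+ 159 / 100 * d + + 103 / 1)) + (+ 59 / 100 * d + 1ℚ)
    lemma = solve-∀ ℚ-ring

  degree≤gap : fromℕ (suc d) ≤ + 100 / 59 * (fromℕ q - fromℕ (suc d))
  degree≤gap = ≤-by _ (+-nonneg (*-nonneg (from-yes (0ℚ ≤? + 100 / 59)) (0≤-diff q≥)) (from-yes (0ℚ ≤? + 10141 / 59)))
    (trans (cong (λ z → + 100 / 59 * (fromℕ q - z) - z) (fromℕ-suc d)) (lemma (fromℕ q) (fromℕ d)))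
    where
    lemma : ∀ q d → + 100 / 59 * (q - (1ℚ + d)) - (1ℚ + d) ≡
            + 100 / 59 * (q - (+ 159 / 100 * d + + 103 / 1)) + + 10141 / 59
    lemma = solve-∀ ℚ-ring

theorem3 : ∃[ β ] 0ℚ < β ×
    (∀ (q d : ℕ) .{{_ : NonZero q}} .{{_ : NonZero d}} →
    fromℕ q ≥ (+ 159 / 100) * fromℕ d + β →
    ∃[ α ] ∃[ C ] ∃[ ζ ]
    0ℚ < α × 0ℚ < C ×
    (∀ (ℓ : ℕ) → 0ℚ ≤ ζ ℓ × ζ ℓ ≤ 1ℚ) ×
    (∀ (ℓ : ℕ) → ζ ℓ ≤ C ·exp (- (α * fromℕ ℓ))) ×
    (∀ (T : FiniteSubtree d) →
    StrongSpatialMixing (FiniteSubtree.graph T) q ζ))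
theorem3 = β , from-yes (0ℚ <? β) , λ q d q≥ → let open Decay d in
  α , C , ζ , from-yes (0ℚ <? α) , C-pos ,
  (λ ℓ → ζ-nonneg ℓ , p⊓q≤p 1ℚ (C * σ ^ ℓ)) , ζ-exp ,
  λ T → let open FiniteSubtree T in
    mixing {d} {q} (gap-large {q} {d} q≥) (degree≤gap {q} {d} q≥) graph embed injective subgraph
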